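{- Let $(T,\omega)$ and $(T',\omega')$ be strictly weighted $2$-stars such that $D_{(T,\mathsf m_\omega)}(\mathbf z)=D_{(T',\mathsf m_{\omega'})}(\mathbf z)$. Then $(T,\omega)$ and $(T',\omega')$ are $\omega$-isomorphic. (That is, a strictly weighted $2$-star can be reconstructed from its $D$-polynomial.)
   Context: A $2$-star is a tree obtained by taking two disjoint stars and joining their centers by an edge. A weighted tree $(T,\omega)$ has $\omega:V(T)\to\{1,2,\dots\}$; it is strictly weighted if all weights exceed $1$. $\omega$-isomorphic means isomorphic via a weight-preserving graph isomorphism. The marked version gives vertex $v$ the mark $(\omega(v),0)$; marks are pairs $(w,d)$ with $w\ge1,d\ge0,w\ge d+1$ and dot-sum $(w,d)\dotplus(w',d')=(w+w',d+d'+1)$. For a marked tree, $M_{(T,\mathsf m)}(\mathbf z)=\sum_{A\subseteq E(T)}\prod_C z_{\mathsf m(C)}$ over the connected components $C$ of $(V(T),A)$, with $\mathsf m(C)$ the dot-sum of the marks of the vertices of $C$ and $z_{w,d}$ commuting indeterminates. With $D_{\bullet_{w,d}}=\sum_{i=0}^d(-1)^i\binom di z_{w-i,0}z_{1,0}^i$, $D_{(T,\mathsf m)}(\mathbf z)$ is $M_{(T,\mathsf m)}$ with each $z_{w,d}$ replaced by $D_{\bullet_{w,d}}$. -}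

module Defs where

open import Level using (0ℓ)
open import Data.Nat as ℕ using (ℕ; zero; suc; _≤_; _<ᵇ_; _≤ᵇ_)
open import Data.Nat.Combinatorics using (_C_)
open import Data.Bool using (Bool; true; false; _∧_; _∨_; not; if_then_else_)
open import Data.Bool.Properties using (∨-comm)
open import Data.Bool.ListAction using (any)
open import Data.Fin using (Fin; toℕ)
open import Data.Fin.Properties using (_≟_)
open import Data.List using (List; []; _∷_; [_]; _++_; map; concatMap; allFin; filterᵇ; upTo; foldr)
open import Data.Product using (Σ; Σ-syntax; _×_; _,_)
open import Function.Bundles using (Bijection; _⤖_)
open import Algebra.Bundles using (CommutativeRing)
open import Relation.Nullary.Decidable using (⌊_⌋)
open import Relation.Binary.PropositionalEquality using (_≡_; refl)

record SimpleGraph (n : ℕ) : Set where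
  field
    adj        : Fin n → Fin n → Bool
    adj-sym    : ∀ u v → adj u v ≡ adj v u
    adj-irrefl : ∀ v → adj v v ≡ false
open SimpleGraph public

GraphIso : ∀ {n m} → SimpleGraph n → SimpleGraph m → Set
GraphIso {n} {m} G H =
  Σ[ f ∈ Fin n ⤖ Fin m ]
    (∀ u v → adj G u v ≡ adj H (Bijection.to f u) (Bijection.to f v))

ωIso : ∀ {n m} → SimpleGraph n → (Fin n → ℕ) → SimpleGraph m → (Fin m → ℕ) → Set
ωIso {n} {m} G ω H ω' =
  Σ[ f ∈ Fin n ⤖ Fin m ]
    ((∀ u v → adj G u v ≡ adj H (Bijection.to f u) (Bijection.to f v))
     × (∀ v → ω v ≡ ω' (Bijection.to f v)))

-- 2-stars.  doubleStar a b has vertex set Fin (2 + a + b):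
-- vertex 0 = centre of the first star K_{1,a}, vertex 1 = centre of the
-- second star K_{1,b}, vertices 2 .. a+1 = leaves of the first star,
-- vertices a+2 .. a+b+1 = leaves of the second star; centres joined.

dsE : ℕ → ℕ → ℕ → Bool
dsE a 0 1 = true
dsE a 0 (suc (suc k)) = k <ᵇ a
dsE a 1 (suc (suc k)) = a ≤ᵇ k
dsE a _ _ = false

dsE-irrefl : ∀ a k → dsE a k k ≡ false
dsE-irrefl a 0 = refl
dsE-irrefl a 1 = refl
dsE-irrefl a (suc (suc k)) = refl

doubleStar : (a b : ℕ) → SimpleGraph (2 ℕ.+ a ℕ.+ b)
doubleStar a b = record
  { adj        = λ u v → dsE a (toℕ u) (toℕ v) ∨ dsE a (toℕ v) (toℕ u)
  ; adj-sym    = λ u v → ∨-comm (dsE a (toℕ u) (toℕ v)) (dsE a (toℕ v) (toℕ u))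
  ; adj-irrefl = λ v → irr (toℕ v)
  }
  where
  irr : ∀ k → (dsE a k k ∨ dsE a k k) ≡ false
  irr k with dsE a k k | dsE-irrefl a k
  ... | .false | refl = refl

Is2Star : ∀ {n} → SimpleGraph n → Set
Is2Star G = Σ[ a ∈ ℕ ] Σ[ b ∈ ℕ ] (1 ≤ a × 1 ≤ b × GraphIso G (doubleStar a b))

StrictlyWeighted : ∀ {n} → (Fin n → ℕ) → Set
StrictlyWeighted ω = ∀ v → 2 ≤ ω v

Mark : Set
Mark = ℕ × ℕ

_∔_ : Mark → Mark → Mark
(w , d) ∔ (w' , d') = (w ℕ.+ w' , suc (d ℕ.+ d'))

dotSumList : Mark → List Mark → Mark
dotSumList m []        = m
dotSumList m (m' ∷ ms) = m ∔ dotSumList m' ms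

markOf : ∀ {n} → (Fin n → ℕ) → Fin n → Mark
markOf ω v = (ω v , 0)

_==_ : ∀ {n} → Fin n → Fin n → Bool
u == v = ⌊ u ≟ v ⌋

edges : ∀ {n} → SimpleGraph n → List (Fin n × Fin n)
edges {n} G =
  concatMap (λ u → concatMap (λ v →
    if adj G u v ∧ (toℕ u <ᵇ toℕ v) then [ (u , v) ] else [])
    (allFin n)) (allFin n)

subsets : ∀ {A : Set} → List A → List (List A)
subsets []       = [ [] ]
subsets (x ∷ xs) = subsets xs ++ map (x ∷_) (subsets xs)

adjA : ∀ {n} → List (Fin n × Fin n) → Fin n → Fin n → Bool
adjA A u v = any (λ e → ((Data.Product.proj₁ e == u) ∧ (Data.Product.proj₂ e == v))
                      ∨ ((Data.Product.proj₁ e == v) ∧ (Data.Product.proj₂ e == u))) A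

reach : ∀ {n} → List (Fin n × Fin n) → ℕ → Fin n → Fin n → Bool
reach A zero    u v = u == v
reach {n} A (suc k) u v = reach A k u v ∨ any (λ w → reach A k u w ∧ adjA A w v) (allFin n)

conn : ∀ {n} → List (Fin n × Fin n) → Fin n → Fin n → Bool
conn {n} A u v = reach A n u v

-- v is the least vertex of its component (one representative per component)
isRep : ∀ {n} → List (Fin n × Fin n) → Fin n → Bool
isRep {n} A v = not (any (λ u → (toℕ u <ᵇ toℕ v) ∧ conn A u v) (allFin n))

compMark : ∀ {n} → (Fin n → Mark) → List (Fin n × Fin n) → Fin n → Mark
compMark {n} m A v =
  dotSumList (m v) (map m (filterᵇ (λ u → conn A v u ∧ not (u == v)) (allFin n)))

-- Polynomials in the commuting indeterminates z_{w,d}, with integer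
-- coefficients, are represented through their evaluations: a polynomial
-- identity P = Q in ℤ[z_{w,d}] holds iff P and Q agree under every
-- assignment z : Mark → R in every commutative ring R (take R = ℤ[z]).

module _ (R : CommutativeRing 0ℓ 0ℓ) where
  open CommutativeRing R

  ΣR : List Carrier → Carrier
  ΣR = foldr _+_ 0#

  ΠR : List Carrier → Carrier
  ΠR = foldr _*_ 1#

  natR : ℕ → Carrier
  natR zero    = 0#
  natR (suc k) = 1# + natR k

  powR : Carrier → ℕ → Carrier
  powR x zero    = 1#
  powR x (suc k) = x * powR x k

  signR : ℕ → Carrier
  signR zero    = 1#
  signR (suc i) = - signR i

  evalM : ∀ {n} → SimpleGraph n → (Fin n → Mark) → (Mark → Carrier) → Carrier
  evalM {n} G m z =
    ΣR (map (λ A → ΠR (map (λ v → z (compMark m A v))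
                           (filterᵇ (isRep A) (allFin n))))
            (subsets (edges G)))

  Dbullet : (Mark → Carrier) → Mark → Carrier
  Dbullet z (w , d) =
    ΣR (map (λ i → signR i * natR (d C i) * z (w ℕ.∸ i , 0) * powR (z (1 , 0)) i)
            (upTo (suc d)))

  evalD : ∀ {n} → SimpleGraph n → (Fin n → Mark) → (Mark → Carrier) → Carrier
  evalD G m z = evalM G m (Dbullet z)

DEqual : ∀ {n n'} → SimpleGraph n → (Fin n → Mark) → SimpleGraph n' → (Fin n' → Mark) → Set₁
DEqual G m G' m' =
  ∀ (R : CommutativeRing 0ℓ 0ℓ) (z : Mark → CommutativeRing.Carrier R) →
    CommutativeRing._≈_ R (evalD R G m z) (evalD R G' m' z)

{-# OPTIONS --safe #-}
module Submission where

open import Defs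
open import Level using (0ℓ)
open import Algebra.Bundles using (CommutativeRing)
open import Data.Bool using (Bool; true; false; T; _∧_; _∨_; not; if_then_else_; _xor_)
import Data.Bool.Properties as Bool
open import Data.Bool.ListAction using (any)
open import Data.Bool.Properties using (T-∧; T-∨; T-≡; ∨-assoc; ∨-comm; ∧-comm; ∨-identityʳ; not-involutive)
open import Data.Fin using (Fin; zero; suc; toℕ; fromℕ<)
open import Data.Fin.Properties using (_≟_; toℕ-injective; toℕ-fromℕ<)
open import Data.Integer as ℤ using (ℤ; 0ℤ; 1ℤ)
import Data.Integer.Properties as ℤ
import Data.Integer.Tactic.RingSolver as ℤ
open import Data.List using (List; []; _∷_; [_]; _++_; map; length; concat; concatMap; filter; filterᵇ; allFin; upTo; lookup; tabulate; drop)
open import Data.List.Membership.Propositional using (_∈_; _∉_; find; lose)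
open import Data.List.Membership.Propositional.Properties using (∈-++⁺ˡ; ∈-++⁺ʳ; ∈-++⁻; ∈-∃++; ∈-allFin; ∈-filter⁺; ∈-filter⁻; ∈-map⁺; ∈-map⁻; ∈-concatMap⁺; ∈-concatMap⁻; ∈-length; ∈-lookup)
open import Data.List.Membership.Propositional.Properties.WithK using (unique∧set⇒bag)
open import Data.List.Properties using (++-assoc; length-++; length-map; length-tabulate; map-++; map-∘; map-id; map-cong; map-cong-local; map-tabulate; filter-++; upTo-∷ʳ; concat-map-[_])
open import Data.List.Relation.Binary.BagAndSetEquality using (∼bag⇒↭)
open import Data.List.Relation.Binary.Permutation.Propositional using (_↭_; ↭-refl; ↭-sym; ↭-trans; ↭-prep; ↭-reflexive; ↭⇒↭ₛ; refl; prep; swap)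
import Data.List.Relation.Binary.Permutation.Propositional as Perm
open import Data.List.Relation.Binary.Permutation.Propositional.Properties using (↭-singleton-inv; ↭-length; ↭-map-inv; map⁺; filter-↭; shift; shifts; ++⁺; ++⁺ˡ; ∈-resp-↭; ∷↭∷ʳ)
import Data.List.Relation.Binary.Permutation.Setoid.Properties as Permₛ
open import Data.List.Relation.Unary.All using (All; []; _∷_)
import Data.List.Relation.Unary.All as All
import Data.List.Relation.Unary.All.Properties as All
open import Data.List.Relation.Unary.AllPairs using ([]; _∷_)
open import Data.List.Relation.Unary.Any using (here; there)
import Data.List.Relation.Unary.Any as Any
open import Data.List.Relation.Unary.Any.Properties using (any⁺; any⁻; lookup-index)
open import Data.List.Relation.Unary.Unique.Propositional using (Unique)
import Data.List.Relation.Unary.Unique.Propositional.Properties as Unique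
open import Data.Nat as ℕ using (ℕ; zero; suc; pred; _+_; _*_; _∸_; _^_; _≤_; _<_; _<ᵇ_; _≤ᵇ_; z≤n; s≤s; z<s; s<s; NonZero; >-nonZero)
open import Data.Nat.Combinatorics using (_C_; nCk+nC[k+1]≡[n+1]C[k+1]; k>n⇒nCk≡0)
open import Data.Nat.DivMod using (_%_; [m+kn]%n≡m%n; m<n⇒m%n≡m)
open import Data.Nat.ListAction using (sum; product)
open import Data.Nat.ListAction.Properties using (sum-++; sum-↭; product-++; product-↭)
import Data.Nat.Properties as ℕ
import Data.Nat.Tactic.RingSolver as ℕ
open import Data.Product using (Σ; ∃; ∃₂; _×_; _,_; proj₁; proj₂)
open import Data.Product.Properties using (≡-dec)
open import Data.Sum using (_⊎_; inj₁; inj₂)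
open import Function using (_∘_; id; Equivalence; mk⇔; _⤖_; mk⤖; Bijection)
open import Relation.Binary using (tri<; tri≈; tri>)
open import Relation.Binary.PropositionalEquality hiding ([_]; setoid)
import Relation.Binary.PropositionalEquality as ≡
open import Relation.Nullary using (¬_; Dec; yes; no; contradiction)
open import Relation.Nullary.Decidable using (toWitness; fromWitness; T?)
open Equivalence using (to; from)

-- A 2-star has few subtrees, and they determine it.  Evaluate D in the dual numbers ℤ[ε]/(ε²) at
-- z₁ = 1 and z_w = k m + ε (k + 1)^w for w ≥ 2.  Then D_{w,d} = [d = 0] k m + ε (k + 1)^(w-d) k^d,
-- so a component with at least two vertices contributes only to first order, and D becomes
-- (k m)^n + ε k^(n-1) x Ψ, where x = k + 1 and Ψ = Σ_C m^(n-|C|) x^(ω(C)-|C|) runs over the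
-- connected vertex sets C.  With centres p, q, leaves A, B and ω' = ω - 1,
--   Ψ = m^(n-1) Σ_{a ∈ A ∪ B} x^ω'(a) + F + G + x^(ω'(p)+ω'(q)) Π_{a ∈ A ∪ B} (m + x^ω'(a)),
--   F = m^(|B|+1) x^ω'(p) Π_{a ∈ A} (m + x^ω'(a)),  and symmetrically G.
-- Reading Ψ modulo m² yields the total weight and the multiset of leaf weights.  The sum F + G and
-- the product F G are then known, hence so is {F, G}; for x = m² the base-m digits of F give the
-- weight of p and the multiset of weights of A.


-- Decoding sums and products of powers

-- With `z₁ = 1`, D_{w,d} is the d-th backward difference of the sequence z_w. Differences of
-- positive order kill the constant k m, and each one contributes a factor x - 1 = k to the
-- geometric part. On a component of d + 1 vertices they reach down only to weight w - d, which is
-- at least d + 2 because every vertex weighs at least 2; so they never meet the exceptional value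
-- `z₁`. This is where strictness enters. Each of the n - |C| lone vertices gives k m and C itself
-- gives k^(|C|-1), so the powers of k collect to k^(n-1) for every C, while m counts the vertices
-- left out.
--
-- The obstacle is that F and G occur in Ψ only through their sum. Their product, however, is
-- symmetric: it involves just the total weight of the centres and the joint multiset of leaf
-- weights, which the reduction modulo m² supplies.
--
-- Taking x = m² rather than x = m turns every leaf factor into m times 1 plus an odd, hence
-- positive, power of m. With x = m a leaf of weight 2 would give 2 m, and the products would no
-- longer be 1 modulo m.

last-digit : ∀ {b r r'} k k' → r < b → r' < b → r + k * b ≡ r' + k' * b → r ≡ r'
last-digit {suc b} {r} {r'} k k' r<b r'<b eq = begin
  r                     ≡⟨ m<n⇒m%n≡m r<b ⟨
  r % suc b             ≡⟨ [m+kn]%n≡m%n r k (suc b) ⟨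
  (r + k * suc b) % suc b   ≡⟨ cong (_% suc b) eq ⟩
  (r' + k' * suc b) % suc b ≡⟨ [m+kn]%n≡m%n r' k' (suc b) ⟩
  r' % suc b            ≡⟨ m<n⇒m%n≡m r'<b ⟩
  r'                    ∎
  where open ≡-Reasoning

minimum : ∀ x xs → ∃ λ e → e ∈ x ∷ xs × All (e ≤_) (x ∷ xs)
minimum x [] = x , here refl , ℕ.≤-refl ∷ []
minimum x (y ∷ xs) with minimum y xs
... | e , e∈ , e≤ with ℕ.≤-total x e
...   | inj₁ x≤e = x , here refl , ℕ.≤-refl ∷ All.map (ℕ.≤-trans x≤e) e≤
...   | inj₂ e≤x = e , there e∈ , e≤x ∷ e≤

extract : ∀ {A : Set} {x : A} {xs} → x ∈ xs → ∃ λ ys → xs ↭ x ∷ ys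
extract x∈ with ∈-∃++ x∈
... | ys , zs , refl = ys ++ zs , shift _ ys zs

-- Base-b digits: the least exponent and its multiplicity can be read off Φ xs, and then cancelled.
module Decode (b : ℕ) .{{_ : NonZero b}} (h : ℕ → ℕ) (u : ℕ) (Φ : List ℕ → ℕ)
  (resp : ∀ {xs ys} → xs ↭ ys → Φ xs ≡ Φ ys)
  (cancel : ∀ e {xs ys} → Φ (e ∷ xs) ≡ Φ (e ∷ ys) → Φ xs ≡ Φ ys)
  (lead : ∀ e xs → All (e ≤_) xs → ∃₂ λ r k → Φ xs ≡ u + (r + k * b) * b ^ h e
            × r ≤ length xs × (e ∈ xs → 0 < r) × (0 < r → e ∈ xs))
  where

  -- With `u` subtracted and `b ^ h e` divided out, both values reduce modulo `b` to their digits
  -- `r`. These are at most the list lengths, hence below `b`, so they agree; and a positive digit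
  -- means membership of `e`.
  same-least : ∀ e {xs ys} → All (e ≤_) xs → All (e ≤_) ys → length xs < b → length ys < b →
               Φ xs ≡ Φ ys → e ∈ xs → e ∈ ys
  same-least e {xs} {ys} e≤xs e≤ys xs<b ys<b eq e∈xs
    with lead e xs e≤xs | lead e ys e≤ys
  ... | r , k , Φxs , r≤ , ∈→r , _ | r' , k' , Φys , r'≤ , _ , r'→∈ =
    r'→∈ (subst (0 <_) r≡r' (∈→r e∈xs))
    where
    r≡r' : r ≡ r'
    r≡r' = last-digit k k' (ℕ.≤-<-trans r≤ xs<b) (ℕ.≤-<-trans r'≤ ys<b)
             (ℕ.*-cancelʳ-≡ _ _ (b ^ h e) {{ℕ.m^n≢0 b (h e)}}
               (ℕ.+-cancelˡ-≡ u _ _ (trans (sym Φxs) (trans eq Φys))))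

  -- The minimum of `xs ++ ys` lies in one list, hence by `same-least` in both, and `cancel` removes
  -- it from each. `n` is fuel, because the remainder given by `extract` is not structurally
  -- smaller.
  injective : ∀ n xs ys → length xs ≤ n → length xs < b → length ys < b → Φ xs ≡ Φ ys → xs ↭ ys
  injective n [] [] _ _ _ _ = ↭-refl
  injective n [] (y ∷ ys) _ <b <b' eq with minimum y ys
  ... | e , e∈ , e≤ with () ← same-least e e≤ [] <b' <b (sym eq) e∈
  injective (suc n) (x ∷ xs) ys (s≤s ≤n) <b <b' eq with minimum x (xs ++ ys)
  ... | e , e∈ , e≤ with both
    where
    e≤ˡ = All.++⁻ˡ (x ∷ xs) e≤
    e≤ʳ = All.++⁻ʳ (x ∷ xs) e≤
    both : e ∈ x ∷ xs × e ∈ ys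
    both with ∈-++⁻ (x ∷ xs) e∈
    ... | inj₁ l = l , same-least e e≤ˡ e≤ʳ <b <b' eq l
    ... | inj₂ r = same-least e e≤ʳ e≤ˡ <b' <b (sym eq) r , r
  ...   | l , r with extract l | extract r
  ...     | xs' , xs↭ | ys' , ys↭ =
    ↭-trans xs↭ (↭-trans (↭-prep e (injective n xs' ys'
        (ℕ.≤-pred (subst (_≤ suc n) (↭-length xs↭) (s≤s ≤n)))
        (ℕ.<-trans (ℕ.n<1+n _) (subst (_< b) (↭-length xs↭) <b))
        (ℕ.<-trans (ℕ.n<1+n _) (subst (_< b) (↭-length ys↭) <b'))
        (cancel e (trans (sym (resp xs↭)) (trans eq (resp ys↭))))))
      (↭-sym ys↭))

^-split : ∀ b {m n} → m < n → b ^ n ≡ b ^ (n ∸ suc m) * b * b ^ m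
^-split b {m} {n} m<n = begin
  b ^ n                        ≡⟨ cong (b ^_) (ℕ.m∸n+n≡m m<n) ⟨
  b ^ (n ∸ suc m + suc m)      ≡⟨ ℕ.^-distribˡ-+-* b (n ∸ suc m) (suc m) ⟩
  b ^ (n ∸ suc m) * (b * b ^ m) ≡⟨ ℕ.*-assoc (b ^ (n ∸ suc m)) b (b ^ m) ⟨
  b ^ (n ∸ suc m) * b * b ^ m  ∎
  where open ≡-Reasoning

powerSum : ℕ → List ℕ → ℕ
powerSum b xs = sum (map (b ^_) xs)

-- The leaf factors `m + x ^ suc a` at `m = b`, `x = b ^ 2`, each divided by `b`.
powerProduct : ℕ → List ℕ → ℕ
powerProduct b xs = product (map (λ a → 1 + b ^ suc (2 * a)) xs)

powerSum-lead : ∀ b e xs → All (e ≤_) xs → ∃₂ λ r k → powerSum b xs ≡ 0 + (r + k * b) * b ^ e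
                  × r ≤ length xs × (e ∈ xs → 0 < r) × (0 < r → e ∈ xs)
powerSum-lead b e [] [] = 0 , 0 , refl , z≤n , (λ ()) , λ ()
powerSum-lead b e (x ∷ xs) (e≤x ∷ e≤xs) with powerSum-lead b e xs e≤xs | ℕ.m≤n⇒m<n∨m≡n e≤x
... | r , k , eq , r≤ , ∈→r , r→∈ | inj₂ refl =
  suc r , k , trans (cong (b ^ e +_) eq) (step (b ^ e) r k b) , s≤s r≤ , (λ _ → z<s) , λ _ → here refl
  where
  step : ∀ E r k b → E + (r + k * b) * E ≡ (1 + r + k * b) * E
  step = ℕ.solve-∀
... | r , k , eq , r≤ , ∈→r , r→∈ | inj₁ e<x =
  r , k + b ^ (x ∸ suc e) , trans (cong₂ _+_ (^-split b e<x) eq) (step (b ^ e) (b ^ (x ∸ suc e)) r k b) ,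
  ℕ.m≤n⇒m≤1+n r≤ , (λ { (here refl) → contradiction e<x (ℕ.<-irrefl refl) ; (there p) → ∈→r p }) , λ p → there (r→∈ p)
  where
  step : ∀ E X r k b → X * b * E + (r + k * b) * E ≡ (r + (k + X) * b) * E
  step = ℕ.solve-∀

-- The exponents are at least 1, so the cross term of two factors is divisible by
-- `b ^ suc (suc (2 * e))` and goes into `k`. The digit `r` therefore counts the occurrences of `e`,
-- as it does for the power sum.
powerProduct-lead : ∀ b e xs → All (e ≤_) xs →
  ∃₂ λ r k → powerProduct b xs ≡ 1 + (r + k * b) * b ^ suc (2 * e)
    × r ≤ length xs × (e ∈ xs → 0 < r) × (0 < r → e ∈ xs)
powerProduct-lead b e [] [] = 0 , 0 , refl , z≤n , (λ ()) , λ ()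
powerProduct-lead b e (x ∷ xs) (e≤x ∷ e≤xs) with powerProduct-lead b e xs e≤xs | ℕ.m≤n⇒m<n∨m≡n e≤x
... | r , k , eq , r≤ , ∈→r , r→∈ | inj₂ refl =
  suc r , k + (r + k * b) * b ^ (2 * e) , trans (cong ((1 + b ^ suc (2 * e)) *_) eq) (step (b ^ (2 * e)) r k b) ,
  s≤s r≤ , (λ _ → z<s) , λ _ → here refl
  where
  step : ∀ E r k b → (1 + b * E) * (1 + (r + k * b) * (b * E))
                     ≡ 1 + (1 + r + (k + (r + k * b) * E) * b) * (b * E)
  step = ℕ.solve-∀
... | r , k , eq , r≤ , ∈→r , r→∈ | inj₁ e<x =
  r , k + X * (1 + (r + k * b) * b ^ suc (2 * e)) ,
  trans (cong₂ (λ y z → (1 + y) * z) (^-split b (s<s (ℕ.*-monoʳ-< 2 e<x))) eq) (step (b ^ suc (2 * e)) X r k b) ,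
  ℕ.m≤n⇒m≤1+n r≤ , (λ { (here refl) → contradiction e<x (ℕ.<-irrefl refl) ; (there p) → ∈→r p }) , λ p → there (r→∈ p)
  where
  X = b ^ (suc (2 * x) ∸ suc (suc (2 * e)))
  step : ∀ E X r k b → (1 + X * b * E) * (1 + (r + k * b) * E)
                       ≡ 1 + (r + (k + X * (1 + (r + k * b) * E)) * b) * E
  step = ℕ.solve-∀

powerSum-injective : ∀ b xs ys → length xs < b → length ys < b → powerSum b xs ≡ powerSum b ys → xs ↭ ys
powerSum-injective b@(suc _) xs ys = D.injective (length xs) xs ys ℕ.≤-refl
  where
  module D = Decode b id 0 (powerSum b) (λ p → sum-↭ (map⁺ (b ^_) p))
               (λ e → ℕ.+-cancelˡ-≡ (b ^ e) _ _) (powerSum-lead b)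

powerProduct-injective : ∀ b xs ys → length xs < b → length ys < b →
                         powerProduct b xs ≡ powerProduct b ys → xs ↭ ys
powerProduct-injective b@(suc _) xs ys = D.injective (length xs) xs ys ℕ.≤-refl
  where
  module D = Decode b (λ e → suc (2 * e)) 1 (powerProduct b) (λ p → product-↭ (map⁺ _ p))
               (λ e → ℕ.*-cancelˡ-≡ _ _ (1 + b ^ suc (2 * e))) (powerProduct-lead b)

^-injectiveʳ : ∀ b {m n} → 1 < b → b ^ m ≡ b ^ n → m ≡ n
^-injectiveʳ b {m} {n} 1<b eq with ℕ.<-cmp m n
... | tri< m<n _ _ = contradiction eq (ℕ.<⇒≢ (ℕ.^-monoʳ-< b 1<b m<n))
... | tri≈ _ m≡n _ = m≡n
... | tri> _ _ n<m = contradiction (sym eq) (ℕ.<⇒≢ (ℕ.^-monoʳ-< b 1<b n<m))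

-- Write `c = a + k`. The sum gives `b = k + d`, and then the product gives `k * a = k * d`; either
-- `k` is 0 or it cancels.
sum-product-determine-≤ : ∀ {a b c d} → a ≤ c → a + b ≡ c + d → a * b ≡ c * d → a ≡ c ⊎ a ≡ d
sum-product-determine-≤ {a} {b} {c} {d} a≤c s p with ℕ.m≤n⇒∃[o]m+o≡n a≤c
... | k , refl with ℕ.+-cancelˡ-≡ a b (k + d) (trans s (ℕ.+-assoc a k d))
sum-product-determine-≤ {a} _ _ _ | zero , refl | refl = inj₁ (sym (ℕ.+-identityʳ a))
sum-product-determine-≤ {a} {d = d} _ _ p | k@(suc _) , refl | refl =
  inj₂ (ℕ.*-cancelˡ-≡ a d k (ℕ.+-cancelʳ-≡ (a * d) _ _ (trans (lhs a k d) (trans p (rhs a k d)))))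
  where
  lhs : ∀ a k d → k * a + a * d ≡ a * (k + d)
  lhs = ℕ.solve-∀
  rhs : ∀ a k d → (a + k) * d ≡ k * d + a * d
  rhs = ℕ.solve-∀

sum-product-determine : ∀ {a b c d} → a + b ≡ c + d → a * b ≡ c * d → (a ≡ c × b ≡ d) ⊎ (a ≡ d × b ≡ c)
sum-product-determine {a} {b} {c} {d} s p with cases
  where
  symmetric : c ≡ a ⊎ c ≡ b → a ≡ c ⊎ a ≡ d
  symmetric (inj₁ refl) = inj₁ refl
  symmetric (inj₂ refl) = inj₂ (ℕ.+-cancelʳ-≡ b a d (trans s (ℕ.+-comm b d)))
  cases : a ≡ c ⊎ a ≡ d
  cases with ℕ.≤-total a c
  ... | inj₁ a≤c = sum-product-determine-≤ a≤c s p
  ... | inj₂ c≤a = symmetric (sum-product-determine-≤ c≤a (sym s) (sym p))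
... | inj₁ refl = inj₁ (refl , ℕ.+-cancelˡ-≡ a b d s)
... | inj₂ refl = inj₂ (refl , ℕ.+-cancelˡ-≡ a b c (trans s (ℕ.+-comm c d)))

-- The subtree polynomial

-- Once its centre belongs to a subtree, a leaf is independently left out (factor `m`) or taken in
-- (factor `x ^ suc a`).
leafProduct : ℕ → ℕ → List ℕ → ℕ
leafProduct x m L = product (map (λ a → m + x ^ suc a) L)

leafSum : ℕ → List ℕ → ℕ
leafSum x L = sum (map (λ a → x ^ suc a) L)

-- The generating function of the subtrees (connected vertex sets) C of a 2-star, graded by
-- x^(weight of C) m^(number of vertices outside C); a vertex of weight ω is entered as ω ∸ 2
-- and contributes the exponent ω ∸ 1.
subtreePoly : (x m p : ℕ) (A : List ℕ) (q : ℕ) (B : List ℕ) → ℕ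
subtreePoly x m p A q B =
  m ^ (1 + (length A + length B)) * leafSum x (A ++ B)
  + (m ^ (1 + length B) * (x ^ suc p * leafProduct x m A)
     + m ^ (1 + length A) * (x ^ suc q * leafProduct x m B))
  + x ^ suc p * x ^ suc q * leafProduct x m (A ++ B)

-- The coefficient of `m` in `leafProduct x m L`: exactly one leaf is left out.
coSum : ℕ → List ℕ → ℕ
coSum x []      = 0
coSum x (a ∷ L) = leafProduct x 0 L + x ^ suc a * coSum x L

leafProduct-expand : ∀ x m L → ∃ λ R → leafProduct x m L ≡ leafProduct x 0 L + m * (coSum x L + m * R)
leafProduct-expand x m [] = 0 , step m
  where
  step : ∀ m → 1 ≡ 1 + m * (0 + m * 0)
  step = ℕ.solve-∀
leafProduct-expand x m (a ∷ L) with leafProduct-expand x m L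
... | R , eq = coSum x L + m * R + x ^ suc a * R ,
  trans (cong ((m + x ^ suc a) *_) eq) (step m (x ^ suc a) (leafProduct x 0 L) (coSum x L) R)
  where
  step : ∀ m X P E R → (m + X) * (P + m * (E + m * R)) ≡ X * P + m * (P + X * E + m * (E + m * R + X * R))
  step = ℕ.solve-∀

leafProduct-0 : ∀ x L → leafProduct x 0 L ≡ x ^ sum (map suc L)
leafProduct-0 x [] = refl
leafProduct-0 x (a ∷ L) = trans (cong (x ^ suc a *_) (leafProduct-0 x L)) (sym (ℕ.^-distribˡ-+-* x (suc a) _))

-- Leaving out the leaf `a` lowers the full exponent by `suc a`. The offset `K` lets the induction
-- absorb the power of the head of the list.
coSum-powerSum : ∀ x K L → x ^ K * coSum x L ≡ powerSum x (map (λ a → K + sum (map suc L) ∸ suc a) L)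
coSum-powerSum x K [] = ℕ.*-zeroʳ (x ^ K)
coSum-powerSum x K (a ∷ L) = begin
  x ^ K * (leafProduct x 0 L + x ^ suc a * coSum x L)
    ≡⟨ cong (λ y → x ^ K * (y + x ^ suc a * coSum x L)) (leafProduct-0 x L) ⟩
  x ^ K * (x ^ S + x ^ suc a * coSum x L)
    ≡⟨ step (x ^ K) (x ^ S) (x ^ suc a) (coSum x L) ⟩
  x ^ K * x ^ S + x ^ K * x ^ suc a * coSum x L
    ≡⟨ cong₂ (λ y z → y + z * coSum x L) (ℕ.^-distribˡ-+-* x K S) (ℕ.^-distribˡ-+-* x K (suc a)) ⟨
  x ^ (K + S) + x ^ (K + suc a) * coSum x L
    ≡⟨ cong₂ _+_ (cong (x ^_) (sym head)) (coSum-powerSum x (K + suc a) L) ⟩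
  x ^ (K + (suc a + S) ∸ suc a) + powerSum x (map (λ b → K + suc a + S ∸ suc b) L)
    ≡⟨ cong (λ y → x ^ (K + (suc a + S) ∸ suc a) + powerSum x (map (λ b → y ∸ suc b) L)) (ℕ.+-assoc K (suc a) S) ⟩
  x ^ (K + (suc a + S) ∸ suc a) + powerSum x (map (λ b → K + (suc a + S) ∸ suc b) L) ∎
  where
  open ≡-Reasoning
  S = sum (map suc L)
  step : ∀ K S X E → K * (S + X * E) ≡ K * S + K * X * E
  step = ℕ.solve-∀
  head : K + (suc a + S) ∸ suc a ≡ K + S
  head = trans (cong (_∸ suc a) (trans (cong (K +_) (ℕ.+-comm (suc a) S)) (sym (ℕ.+-assoc K S (suc a)))))
               (ℕ.m+n∸n≡m (K + S) (suc a))

-- The weight of the whole tree less its number of vertices.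
totalWeight : ℕ → ℕ → List ℕ → ℕ
totalWeight p q L = suc p + suc q + sum (map suc L)

-- A subtree missing at most one vertex misses only leaves, so modulo m² the subtree polynomial sees just these.
subtreePoly-expand : ∀ x m p A q B → 0 < length A → 0 < length B → ∃ λ R →
  subtreePoly x m p A q B ≡ x ^ totalWeight p q (A ++ B)
    + (powerSum x (map (λ a → totalWeight p q (A ++ B) ∸ suc a) (A ++ B)) + R * m) * m
-- As both leaf lists are nonempty, `m ^ (1 + length A)` and `m ^ (1 + length B)` unfold to
-- multiples of `m * m`, so subtrees that miss a centre go into the remainder.
subtreePoly-expand x m p A@(_ ∷ A₁) q B@(_ ∷ B₁) _ _ with leafProduct-expand x m (A ++ B)
... | R , eq = R' , trans (cong (λ y → U + V + x ^ suc p * x ^ suc q * y) eq)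
   (trans (step m (m ^ (length A₁ + length B)) (leafSum x (A ++ B)) (m ^ length B₁) (x ^ suc p * leafProduct x m A)
     (m ^ length A₁) (x ^ suc q * leafProduct x m B) (x ^ suc p * x ^ suc q) (leafProduct x 0 (A ++ B)) (coSum x (A ++ B)) R)
   (cong₂ (λ y z → y + (z + R' * m) * m)
     (trans (cong₂ _*_ (sym (ℕ.^-distribˡ-+-* x (suc p) (suc q))) (leafProduct-0 x (A ++ B)))
            (sym (ℕ.^-distribˡ-+-* x (suc p + suc q) _)))
     (trans (cong (_* coSum x (A ++ B)) (sym (ℕ.^-distribˡ-+-* x (suc p) (suc q))))
            (coSum-powerSum x (suc p + suc q) (A ++ B)))))
  where
  U = m ^ (1 + (length A + length B)) * leafSum x (A ++ B)
  R' = m ^ (length A₁ + length B) * leafSum x (A ++ B)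
    + (m ^ length B₁ * (x ^ suc p * leafProduct x m A) + m ^ length A₁ * (x ^ suc q * leafProduct x m B))
    + x ^ suc p * x ^ suc q * R
  V = m ^ (1 + length B) * (x ^ suc p * leafProduct x m A) + m ^ (1 + length A) * (x ^ suc q * leafProduct x m B)
  step : ∀ m M S MB F MA G X P E R →
    m * (m * M) * S + (m * (m * MB) * F + m * (m * MA) * G) + X * (P + m * (E + m * R))
    ≡ X * P + (X * E + (M * S + (MB * F + MA * G) + X * R) * m) * m
  step = ℕ.solve-∀

complement-injective : ∀ N L L' → All (λ a → suc a ≤ N) L → All (λ a → suc a ≤ N) L' →
  map (λ a → N ∸ suc a) L ↭ map (λ a → N ∸ suc a) L' → L ↭ L'
complement-injective N L L' L≤ L'≤ p =
  subst₂ _↭_ (undo L L≤) (undo L' L'≤) (map⁺ (λ e → pred (N ∸ e)) p)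
  where
  undo : ∀ L → All (λ a → suc a ≤ N) L → map (λ e → pred (N ∸ e)) (map (λ a → N ∸ suc a) L) ≡ L
  undo []      []         = refl
  undo (a ∷ L) (a≤ ∷ L≤) = cong₂ _∷_ (cong pred (ℕ.m∸[m∸n]≡n a≤)) (undo L L≤)

all≤sum : ∀ L → All (λ a → suc a ≤ sum (map suc L)) L
all≤sum [] = []
all≤sum (a ∷ L) = ℕ.m≤m+n (suc a) _ ∷ All.map (λ a≤ → ℕ.≤-trans a≤ (ℕ.m≤n+m _ (suc a))) (all≤sum L)

-- The whole tree and the trees missing one leaf give the two lowest base-`m` digits, provided `m`
-- exceeds both. As the hypothesis holds for all `k` and `m`, `m` can be chosen after `x`.
leaves-determined : ∀ p A q B p' A' q' B' → 0 < length A → 0 < length B → 0 < length A' → 0 < length B' →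
  (∀ k m → subtreePoly (2 + k) m p A q B ≡ subtreePoly (2 + k) m p' A' q' B') →
  totalWeight p q (A ++ B) ≡ totalWeight p' q' (A' ++ B') × A ++ B ↭ A' ++ B'
leaves-determined p A q B p' A' q' B' A>0 B>0 A'>0 B'>0 eq = W≡W' , L↭L'
  where
  L  = A ++ B
  L' = A' ++ B'
  W  = totalWeight p q L
  W' = totalWeight p' q' L'
  -- This puts the base `x = 2 + k` above both numbers of leaves, so the power sums decode without
  -- carries.
  k  = length L + length L'
  x  = 2 + k
  a₁  = powerSum x (map (λ a → W ∸ suc a) L)
  a₁' = powerSum x (map (λ a → W' ∸ suc a) L')
  -- Larger than both digits to be read off, on either side.
  m  = suc (x ^ W + x ^ W' + (a₁ + a₁'))
  e  = subtreePoly-expand x m p A q B A>0 B>0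
  e' = subtreePoly-expand x m p' A' q' B' A'>0 B'>0
  eq₀ = trans (sym (proj₂ e)) (trans (eq k m) (proj₂ e'))
  x^W≡ : x ^ W ≡ x ^ W'
  x^W≡ = last-digit (a₁ + proj₁ e * m) (a₁' + proj₁ e' * m)
    (s≤s (ℕ.≤-trans (ℕ.m≤m+n (x ^ W) (x ^ W')) (ℕ.m≤m+n _ (a₁ + a₁'))))
    (s≤s (ℕ.≤-trans (ℕ.m≤n+m (x ^ W') (x ^ W)) (ℕ.m≤m+n _ (a₁ + a₁')))) eq₀
  W≡W' : W ≡ W'
  W≡W' = ^-injectiveʳ x (s≤s z<s) x^W≡
  eq₁ : a₁ + proj₁ e * m ≡ a₁' + proj₁ e' * m
  eq₁ = ℕ.*-cancelʳ-≡ _ _ m (ℕ.+-cancelˡ-≡ (x ^ W) _ _ (trans eq₀ (cong (_+ (a₁' + proj₁ e' * m) * m) (sym x^W≡))))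
  a₁≡ : a₁ ≡ a₁'
  a₁≡ = last-digit (proj₁ e) (proj₁ e')
    (s≤s (ℕ.≤-trans (ℕ.m≤m+n a₁ a₁') (ℕ.m≤n+m _ (x ^ W + x ^ W'))))
    (s≤s (ℕ.≤-trans (ℕ.m≤n+m a₁' a₁) (ℕ.m≤n+m _ (x ^ W + x ^ W')))) eq₁
  length< : ∀ {N} (f : ℕ → ℕ) M → length M ≤ N → length (map f M) < 2 + N
  length< f M M≤ = subst (_< _) (sym (length-map f M)) (s≤s (ℕ.m≤n⇒m≤1+n M≤))
  bound : ∀ p q L → All (λ a → suc a ≤ totalWeight p q L) L
  bound p q L = All.map (λ a≤ → ℕ.≤-trans a≤ (ℕ.m≤n+m _ (suc p + suc q))) (all≤sum L)
  L↭L' : L ↭ L'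
  L↭L' = complement-injective W L L' (bound p q L) (subst (λ N → All (λ a → suc a ≤ N) L') (sym W≡W') (bound p' q' L'))
    (powerSum-injective x _ _ (length< _ L (ℕ.m≤m+n _ _)) (length< _ L' (ℕ.m≤n+m _ (length L)))
      (trans a₁≡ (cong (λ N → powerSum x (map (λ a → N ∸ suc a) L')) (sym W≡W'))))

leafProduct-square : ∀ b A → leafProduct (b ^ 2) b A ≡ b ^ length A * powerProduct b A
leafProduct-square b [] = refl
leafProduct-square b (a ∷ A) = begin
  (b + (b ^ 2) ^ suc a) * leafProduct (b ^ 2) b A
    ≡⟨ cong₂ (λ y z → (b + y) * z)
         (trans (ℕ.^-*-assoc b 2 (suc a)) (cong (b ^_) (ℕ.*-suc 2 a))) (leafProduct-square b A) ⟩
  (b + b * b ^ suc (2 * a)) * (b ^ length A * powerProduct b A)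
    ≡⟨ step b (b ^ suc (2 * a)) (b ^ length A) (powerProduct b A) ⟩
  b * b ^ length A * ((1 + b ^ suc (2 * a)) * powerProduct b A) ∎
  where
  open ≡-Reasoning
  step : ∀ b E M P → (b + b * E) * (M * P) ≡ b * M * ((1 + E) * P)
  step = ℕ.solve-∀

powerProduct-mod : ∀ b A → ∃ λ k → powerProduct b A ≡ 1 + k * b
powerProduct-mod b A with powerProduct-lead b 0 A (All.universal (λ _ → z≤n) A)
... | r , k , eq , _ = r + k * b , trans eq (cong (λ y → 1 + (r + k * b) * y) (ℕ.*-identityʳ b))

-- Since `powerProduct` is 1 modulo `b`, dividing by `b ^ P` leaves 1 modulo `b` on the left, but a
-- multiple of `b` on the right if `P < P'`.
star-exponent-≮ : ∀ b {P P'} A A' → 1 < b → b ^ P * powerProduct b A ≡ b ^ P' * powerProduct b A' → ¬ P < P'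
star-exponent-≮ b {P} {P'} A A' 1<b eq P<P' with powerProduct-mod b A
... | k , eqA = contradiction (last-digit {b} {1} {0} k Q 1<b (ℕ.<-trans z<s 1<b) mod) λ ()
  where
  b≢0 = >-nonZero (ℕ.<-trans z<s 1<b)
  Q = b ^ (P' ∸ suc P) * powerProduct b A'
  step : ∀ X b E Y → X * b * E * Y ≡ E * (0 + X * Y * b)
  step = ℕ.solve-∀
  mod : 1 + k * b ≡ 0 + Q * b
  mod = ℕ.*-cancelˡ-≡ _ _ (b ^ P) {{ℕ.m^n≢0 b P {{b≢0}}}}
    (trans (cong (b ^ P *_) (sym eqA)) (trans eq
      (trans (cong (_* powerProduct b A') (^-split b P<P')) (step (b ^ (P' ∸ suc P)) b (b ^ P) (powerProduct b A')))))

star-determined : ∀ b {p p'} A A' → 1 < b → length A < b → length A' < b →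
  b ^ (2 * suc p) * powerProduct b A ≡ b ^ (2 * suc p') * powerProduct b A' → p ≡ p' × A ↭ A'
star-determined b {p} {p'} A A' 1<b A<b A'<b eq with ℕ.<-cmp (2 * suc p) (2 * suc p')
... | tri< lt _ _ = contradiction lt (star-exponent-≮ b A A' 1<b eq)
... | tri> _ _ gt = contradiction gt (star-exponent-≮ b A' A 1<b (sym eq))
... | tri≈ _ P≡P' _ with ℕ.suc-injective (ℕ.*-cancelˡ-≡ (suc p) (suc p') 2 P≡P')
...   | refl = refl , powerProduct-injective b A A' A<b A'<b
         (ℕ.*-cancelˡ-≡ _ _ (b ^ (2 * suc p)) {{ℕ.m^n≢0 b (2 * suc p) {{>-nonZero (ℕ.<-trans z<s 1<b)}}}} eq)

-- The two stars have known sum and known product, hence are known up to order.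
2-star-determined : ∀ p A q B p' A' q' B' → 0 < length A → 0 < length B → 0 < length A' → 0 < length B' →
  length A + length B ≡ length A' + length B' →
  (∀ k m → subtreePoly (2 + k) m p A q B ≡ subtreePoly (2 + k) m p' A' q' B') →
  ((p ≡ p' × A ↭ A') × (q ≡ q' × B ↭ B')) ⊎ ((p ≡ q' × A ↭ B') × (q ≡ p' × B ↭ A'))
2-star-determined p A q B p' A' q' B' A>0 B>0 A'>0 B'>0 |L|≡ eq = conclude (sum-product-determine sum≡ product≡)
  where
  leaves = leaves-determined p A q B p' A' q' B' A>0 B>0 A'>0 B'>0 eq
  L↭L' = proj₂ leaves
  n = length A + length B
  -- Larger than 1 and than the length of every leaf list, as `star-determined` requires.
  b = 2 + n
  x = b ^ 2
  centres≡ : suc p + suc q ≡ suc p' + suc q'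
  centres≡ = ℕ.+-cancelʳ-≡ (sum (map suc (A ++ B))) _ _
    (trans (proj₁ leaves) (cong (suc p' + suc q' +_) (sym (sum-↭ (map⁺ suc L↭L')))))
  X≡ : x ^ suc p * x ^ suc q ≡ x ^ suc p' * x ^ suc q'
  X≡ = trans (sym (ℕ.^-distribˡ-+-* x (suc p) (suc q)))
    (trans (cong (x ^_) centres≡) (ℕ.^-distribˡ-+-* x (suc p') (suc q')))
  Π≡ : leafProduct x b (A ++ B) ≡ leafProduct x b (A' ++ B')
  Π≡ = product-↭ (map⁺ _ L↭L')
  top≡ : b ^ (1 + n) * leafSum x (A ++ B) ≡ b ^ (1 + (length A' + length B')) * leafSum x (A' ++ B')
  top≡ = cong₂ (λ i y → b ^ (1 + i) * y) |L|≡ (sum-↭ (map⁺ _ L↭L'))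
  star : ℕ → List ℕ → List ℕ → ℕ
  star p A B = b ^ (1 + length B) * (x ^ suc p * leafProduct x b A)
  -- In the product the centres and the leaves enter symmetrically, so only quantities already known
  -- for both trees remain.
  product-star : ∀ p A q B → star p A B * star q B A
    ≡ b ^ (2 + (length A + length B)) * (x ^ suc p * x ^ suc q) * leafProduct x b (A ++ B)
  product-star p A q B = trans
    (step b (b ^ length B) (b ^ length A) (x ^ suc p) (x ^ suc q) (leafProduct x b A) (leafProduct x b B))
    (cong₂ (λ y z → b * (b * y) * (x ^ suc p * x ^ suc q) * z)
      (sym (ℕ.^-distribˡ-+-* b (length A) (length B)))
      (sym (trans (cong product (map-++ _ A B)) (product-++ (map _ A) (map _ B)))))
    where
    step : ∀ b M N X Y F G → b * M * (X * F) * (b * N * (Y * G)) ≡ b * (b * (N * M)) * (X * Y) * (F * G)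
    step = ℕ.solve-∀
  sum≡ : star p A B + star q B A ≡ star p' A' B' + star q' B' A'
  sum≡ = ℕ.+-cancelˡ-≡ (b ^ (1 + n) * leafSum x (A ++ B)) _ _
    (ℕ.+-cancelʳ-≡ (x ^ suc p * x ^ suc q * leafProduct x b (A ++ B)) _ _
      -- `2 + (b ^ 2 ∸ 2)` computes to `b ^ 2`, because `b` is `2 + n`.
      (trans (eq (b ^ 2 ∸ 2) b) (cong₂ (λ y z → y + (star p' A' B' + star q' B' A') + z) (sym top≡) (sym (cong₂ _*_ X≡ Π≡)))))
  product≡ : star p A B * star q B A ≡ star p' A' B' * star q' B' A'
  product≡ = trans (product-star p A q B) (trans
    (cong₂ _*_ (cong₂ (λ i y → b ^ (2 + i) * y) |L|≡ X≡) Π≡) (sym (product-star p' A' q' B')))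
  -- The factor `b` of each vertex outside the star and the factor `b` extracted from each leaf
  -- inside it collect to `b ^ (1 + n)`, however the leaves are distributed; it cancels before the
  -- sizes of the stars are known.
  normal : ∀ p A B → length A + length B ≡ n →
    star p A B ≡ b ^ (1 + n) * (b ^ (2 * suc p) * powerProduct b A)
  normal p A B |AB|≡ = trans
    (cong₂ (λ y z → b ^ (1 + length B) * (y * z)) (ℕ.^-*-assoc b 2 (suc p)) (leafProduct-square b A))
    (trans (step b (b ^ length B) (b ^ length A) (b ^ (2 * suc p)) (powerProduct b A))
      (cong (λ y → b * y * (b ^ (2 * suc p) * powerProduct b A))
        (trans (sym (ℕ.^-distribˡ-+-* b (length A) (length B))) (cong (b ^_) |AB|≡))))
    where
    step : ∀ b M N E P → b * M * (E * (N * P)) ≡ b * (N * M) * (E * P)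
    step = ℕ.solve-∀
  decode : ∀ {p p'} A B A' B' → length A + length B ≡ n → length A' + length B' ≡ n →
    star p A B ≡ star p' A' B' → p ≡ p' × A ↭ A'
  decode {p} {p'} A B A' B' l l' e = star-determined b A A' (s≤s z<s) (bound A B l) (bound A' B' l')
    (ℕ.*-cancelˡ-≡ _ _ (b ^ (1 + n)) {{ℕ.m^n≢0 b (1 + n)}} (trans (sym (normal p A B l)) (trans e (normal p' A' B' l'))))
    where
    bound : ∀ A B → length A + length B ≡ n → length A < b
    bound A B l = s≤s (ℕ.m≤n⇒m≤1+n (subst (length A ≤_) l (ℕ.m≤m+n _ _)))
  BA : length B + length A ≡ n
  BA = ℕ.+-comm (length B) (length A)
  A'B' : length A' + length B' ≡ n
  A'B' = sym |L|≡
  B'A' : length B' + length A' ≡ n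
  B'A' = trans (ℕ.+-comm (length B') (length A')) A'B'
  conclude : (star p A B ≡ star p' A' B' × star q B A ≡ star q' B' A') ⊎
             (star p A B ≡ star q' B' A' × star q B A ≡ star p' A' B') → _
  conclude (inj₁ (e , e')) = inj₁ (decode A B A' B' refl A'B' e , decode B A B' A' BA B'A' e')
  conclude (inj₂ (e , e')) = inj₂ (decode A B B' A' refl B'A' e , decode B A A' B' BA A'B' e')

-- Evaluation in the dual numbers

infixl 6 _⊕_
infixl 7 _⊛_

_⊕_ _⊛_ : ℤ × ℤ → ℤ × ℤ → ℤ × ℤ
(a , b) ⊕ (c , d) = a ℤ.+ c , b ℤ.+ d
(a , b) ⊛ (c , d) = a ℤ.* c , a ℤ.* d ℤ.+ b ℤ.* c

dualNumbers : CommutativeRing 0ℓ 0ℓ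
dualNumbers = record
  { Carrier = ℤ × ℤ
  ; _≈_ = _≡_
  ; _+_ = _⊕_
  ; _*_ = _⊛_
  ; -_ = λ (a , b) → ℤ.- a , ℤ.- b
  ; 0# = 0ℤ , 0ℤ
  ; 1# = 1ℤ , 0ℤ
  ; isCommutativeRing = record
    { isRing = record
      { +-isAbelianGroup = record
        { isGroup = record
          { isMonoid = record
            { isSemigroup = record
              { isMagma = record { isEquivalence = isEquivalence ; ∙-cong = cong₂ _⊕_ }
              ; assoc = λ (a , b) (c , d) (e , f) → cong₂ _,_ (ℤ.+-assoc a c e) (ℤ.+-assoc b d f)
              }
            ; identity = (λ (a , b) → cong₂ _,_ (ℤ.+-identityˡ a) (ℤ.+-identityˡ b))
                       , (λ (a , b) → cong₂ _,_ (ℤ.+-identityʳ a) (ℤ.+-identityʳ b))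
            }
          ; inverse = (λ (a , b) → cong₂ _,_ (ℤ.+-inverseˡ a) (ℤ.+-inverseˡ b))
                    , (λ (a , b) → cong₂ _,_ (ℤ.+-inverseʳ a) (ℤ.+-inverseʳ b))
          ; ⁻¹-cong = cong (λ (a , b) → ℤ.- a , ℤ.- b)
          }
        ; comm = λ (a , b) (c , d) → cong₂ _,_ (ℤ.+-comm a c) (ℤ.+-comm b d)
        }
      ; *-cong = cong₂ _⊛_
      ; *-assoc = λ (a , b) (c , d) (e , f) → cong₂ _,_ (ℤ.*-assoc a c e) (assoc a b c d e f)
      ; *-identity = (λ (a , b) → cong₂ _,_ (ℤ.*-identityˡ a) (identityˡ a b))
                   , (λ (a , b) → cong₂ _,_ (ℤ.*-identityʳ a) (identityʳ a b))
      ; distrib = (λ (a , b) (c , d) (e , f) → cong₂ _,_ (ℤ.*-distribˡ-+ a c e) (distribˡ a b c d e f))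
                , (λ (a , b) (c , d) (e , f) → cong₂ _,_ (ℤ.*-distribʳ-+ a c e) (distribʳ a b c d e f))
      }
    ; *-comm = λ (a , b) (c , d) → cong₂ _,_ (ℤ.*-comm a c) (comm a b c d)
    }
  }
  where
  assoc : ∀ a b c d e f → a ℤ.* c ℤ.* f ℤ.+ (a ℤ.* d ℤ.+ b ℤ.* c) ℤ.* e ≡ a ℤ.* (c ℤ.* f ℤ.+ d ℤ.* e) ℤ.+ b ℤ.* (c ℤ.* e)
  assoc = ℤ.solve-∀
  identityˡ : ∀ a b → 1ℤ ℤ.* b ℤ.+ 0ℤ ℤ.* a ≡ b
  identityˡ = ℤ.solve-∀
  identityʳ : ∀ a b → a ℤ.* 0ℤ ℤ.+ b ℤ.* 1ℤ ≡ b
  identityʳ = ℤ.solve-∀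
  distribˡ : ∀ a b c d e f → a ℤ.* (d ℤ.+ f) ℤ.+ b ℤ.* (c ℤ.+ e) ≡ a ℤ.* d ℤ.+ b ℤ.* c ℤ.+ (a ℤ.* f ℤ.+ b ℤ.* e)
  distribˡ = ℤ.solve-∀
  distribʳ : ∀ a b c d e f → (c ℤ.+ e) ℤ.* b ℤ.+ (d ℤ.+ f) ℤ.* a ≡ c ℤ.* b ℤ.+ d ℤ.* a ℤ.+ (e ℤ.* b ℤ.+ f ℤ.* a)
  distribʳ = ℤ.solve-∀
  comm : ∀ a b c d → a ℤ.* d ℤ.+ b ℤ.* c ≡ c ℤ.* b ℤ.+ d ℤ.* a
  comm = ℤ.solve-∀

module 𝔻 = CommutativeRing dualNumbers

ι : ℕ → ℕ → ℤ × ℤ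
ι a b = ℤ.+ a , ℤ.+ b

ι-⊛ : ∀ a b c d → ι a b ⊛ ι c d ≡ ι (a * c) (a * d + b * c)
ι-⊛ a b c d = cong₂ _,_ (sym (ℤ.pos-* a c)) (cong₂ ℤ._+_ (sym (ℤ.pos-* a d)) (sym (ℤ.pos-* b c)))

-- Sums over the splittings of a list

module _ (R : CommutativeRing 0ℓ 0ℓ) where
  open CommutativeRing R using (Carrier; _≈_; 0#; setoid; +-cong; +-congˡ; +-congʳ; +-comm; +-assoc; distribˡ)
    renaming (_+_ to _⊹_; _*_ to _·_; refl to ≈-refl; sym to ≈-sym; trans to ≈-trans)
  open import Relation.Binary.Reasoning.Setoid setoid

  ΣR-∷ʳ : ∀ xs x → ΣR R (xs ++ [ x ]) ≈ ΣR R xs ⊹ x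
  ΣR-∷ʳ [] x = +-comm x 0#
  ΣR-∷ʳ (y ∷ xs) x = begin
    y ⊹ ΣR R (xs ++ [ x ])  ≈⟨ +-congˡ (ΣR-∷ʳ xs x) ⟩
    y ⊹ (ΣR R xs ⊹ x)       ≈⟨ +-assoc y _ x ⟨
    y ⊹ ΣR R xs ⊹ x         ∎

  -- The complement `U` is passed along with the selection `S` because unselected leaves are
  -- components of their own.
  Σsplit : ∀ {X : Set} → List X → (List X → List X → Carrier) → Carrier
  Σsplit []       f = f [] []
  Σsplit (x ∷ xs) f = Σsplit xs (λ S U → f S (x ∷ U)) ⊹ Σsplit xs (λ S U → f (x ∷ S) U)

  Σsplit-map : ∀ {X Y : Set} (g : X → Y) xs f →
    Σsplit (map g xs) f ≡ Σsplit xs (λ S U → f (map g S) (map g U))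
  Σsplit-map g []       f = refl
  Σsplit-map g (x ∷ xs) f =
    cong₂ _⊹_ (Σsplit-map g xs (λ S U → f S (g x ∷ U))) (Σsplit-map g xs (λ S U → f (g x ∷ S) U))

  Σsplit-cong : ∀ {X : Set} (xs : List X) {f g} → (∀ S U → f S U ≈ g S U) → Σsplit xs f ≈ Σsplit xs g
  Σsplit-cong []       f≈g = f≈g [] []
  Σsplit-cong (x ∷ xs) f≈g = +-cong (Σsplit-cong xs (λ S U → f≈g S (x ∷ U))) (Σsplit-cong xs (λ S U → f≈g (x ∷ S) U))

  Σsplit-*ˡ : ∀ {X : Set} a (xs : List X) f → Σsplit xs (λ S U → a · f S U) ≈ a · Σsplit xs f
  Σsplit-*ˡ a []       f = ≈-refl
  Σsplit-*ˡ a (x ∷ xs) f = ≈-trans (+-cong (Σsplit-*ˡ a xs _) (Σsplit-*ˡ a xs _)) (≈-sym (distribˡ a _ _))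

  Σsplit-+ : ∀ {X : Set} (xs : List X) f g → Σsplit xs (λ S U → f S U ⊹ g S U) ≈ Σsplit xs f ⊹ Σsplit xs g
  Σsplit-+ []       f g = ≈-refl
  Σsplit-+ (x ∷ xs) f g = begin
    _  ≈⟨ +-cong (Σsplit-+ xs _ _) (Σsplit-+ xs _ _) ⟩
    (a ⊹ b) ⊹ (c ⊹ d)  ≈⟨ +-assoc a b (c ⊹ d) ⟩
    a ⊹ (b ⊹ (c ⊹ d))  ≈⟨ +-congˡ (≈-trans (≈-sym (+-assoc b c d)) (≈-trans (+-congʳ (+-comm b c)) (+-assoc c b d))) ⟩
    a ⊹ (c ⊹ (b ⊹ d))  ≈⟨ +-assoc a c (b ⊹ d) ⟨
    (a ⊹ c) ⊹ (b ⊹ d)  ∎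
    where
    a = Σsplit xs (λ S U → f S (x ∷ U))
    b = Σsplit xs (λ S U → g S (x ∷ U))
    c = Σsplit xs (λ S U → f (x ∷ S) U)
    d = Σsplit xs (λ S U → g (x ∷ S) U)

-- The value of D at the chosen point

module Evaluation (k m : ℕ) where
  x c : ℕ
  x = suc k
  c = k * m

  -- Weight 1 is exempt from the geometric rule so that the powers of z_{1,0} in `Dbullet` become 1.
  -- The value at weight 0 is a default.
  ζ : Mark → ℤ × ℤ
  ζ (zero , _)          = 𝔻.1#
  ζ (suc zero , _)      = 𝔻.1#
  ζ (w@(suc (suc _)) , _) = ι c (x ^ w)

  -- The number `n` of terms is kept apart from the order `d` of the difference, so that Pascal's
  -- rule can be proved by induction on `n`.
  altSum : ℕ → (ℕ → ℤ × ℤ) → ℕ → ℤ × ℤ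
  altSum d F zero    = 𝔻.0#
  altSum d F (suc n) = altSum d F n ⊕ signR dualNumbers n ⊛ natR dualNumbers (d C n) ⊛ F n

  natR-+ : ∀ i j → natR dualNumbers (i + j) ≡ natR dualNumbers i ⊕ natR dualNumbers j
  natR-+ zero    j = sym (𝔻.+-identityˡ _)
  natR-+ (suc i) j = trans (cong (𝔻.1# ⊕_) (natR-+ i j)) (sym (𝔻.+-assoc 𝔻.1# (natR dualNumbers i) (natR dualNumbers j)))

  -- Pascal's rule splits each binomial coefficient; the part with lower index `i ∸ 1` is the sum
  -- for the shifted sequence, with opposite sign.
  altSum-pascal : ∀ d F n → altSum (suc d) F (suc n) ≡ altSum d F (suc n) ⊕ 𝔻.- altSum d (λ i → F (suc i)) n
  altSum-pascal d F zero = sym (𝔻.+-identityʳ _)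
  altSum-pascal d F (suc n) = begin
    altSum (suc d) F (suc n) ⊕ 𝔻.- s ⊛ natR dualNumbers (suc d C suc n) ⊛ y
      ≡⟨ cong₂ (λ u v → u ⊕ 𝔻.- s ⊛ v ⊛ y) (altSum-pascal d F n)
           (trans (cong (natR dualNumbers) (sym (nCk+nC[k+1]≡[n+1]C[k+1] d n))) (natR-+ (d C n) (d C suc n))) ⟩
    (X ⊕ 𝔻.- Y) ⊕ 𝔻.- s ⊛ (a ⊕ b) ⊛ y
      ≡⟨ cong₂ _,_ (fst (proj₁ X) (proj₁ Y) (proj₁ s) (proj₁ a) (proj₁ b) (proj₁ y))
                   (snd (proj₂ X) (proj₂ Y) (proj₁ s) (proj₂ s) (proj₁ a) (proj₂ a) (proj₁ b) (proj₂ b) (proj₁ y) (proj₂ y)) ⟩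
    (X ⊕ 𝔻.- s ⊛ b ⊛ y) ⊕ 𝔻.- (Y ⊕ s ⊛ a ⊛ y) ∎
    where
    open ≡-Reasoning
    s = signR dualNumbers n
    y = F (suc n)
    X = altSum d F (suc n)
    Y = altSum d (λ i → F (suc i)) n
    a = natR dualNumbers (d C n)
    b = natR dualNumbers (d C suc n)
    fst : ∀ X Y s a b y → X ℤ.+ ℤ.- Y ℤ.+ ℤ.- s ℤ.* (a ℤ.+ b) ℤ.* y ≡ X ℤ.+ ℤ.- s ℤ.* b ℤ.* y ℤ.+ ℤ.- (Y ℤ.+ s ℤ.* a ℤ.* y)
    fst = ℤ.solve-∀
    snd : ∀ X Y s s' a a' b b' y y' →
      X ℤ.+ ℤ.- Y ℤ.+ (ℤ.- s ℤ.* (a ℤ.+ b) ℤ.* y' ℤ.+ (ℤ.- s ℤ.* (a' ℤ.+ b') ℤ.+ ℤ.- s' ℤ.* (a ℤ.+ b)) ℤ.* y)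
      ≡ X ℤ.+ (ℤ.- s ℤ.* b ℤ.* y' ℤ.+ (ℤ.- s ℤ.* b' ℤ.+ ℤ.- s' ℤ.* b) ℤ.* y) ℤ.+ ℤ.- (Y ℤ.+ (s ℤ.* a ℤ.* y' ℤ.+ (s ℤ.* a' ℤ.+ s' ℤ.* a) ℤ.* y))
    snd = ℤ.solve-∀

  -- The real part of D_{w,d}: a difference of positive order kills the constant `c`.
  δ : ℕ → ℕ
  δ zero    = c
  δ (suc d) = 0

  -- Each difference subtracts from a geometric sequence its shift by one, which multiplies it by
  -- `x - 1 = k`. Only the terms up to `d` are constrained, so the exponents stay natural; `g`
  -- absorbs the factor `x` in the induction.
  altSum-geometric : ∀ d F g → (∀ i → i ≤ d → F i ≡ ι c (x ^ (d ∸ i) * g)) →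
    altSum d F (suc d) ≡ ι (δ d) (g * k ^ d)
  altSum-geometric zero F g F≡ = begin
    𝔻.0# ⊕ 𝔻.1# ⊛ (𝔻.1# ⊕ 𝔻.0#) ⊛ F 0  ≡⟨ cong (λ y → 𝔻.0# ⊕ 𝔻.1# ⊛ y ⊛ F 0) (𝔻.+-identityʳ 𝔻.1#) ⟩
    𝔻.0# ⊕ 𝔻.1# ⊛ 𝔻.1# ⊛ F 0          ≡⟨ 𝔻.+-identityˡ _ ⟩
    𝔻.1# ⊛ 𝔻.1# ⊛ F 0                 ≡⟨ cong (_⊛ F 0) (𝔻.*-identityˡ 𝔻.1#) ⟩
    𝔻.1# ⊛ F 0                        ≡⟨ 𝔻.*-identityˡ (F 0) ⟩
    F 0                               ≡⟨ F≡ 0 z≤n ⟩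
    ι c (1 * g)                     ≡⟨ cong (ι c) (ℕ.*-comm 1 g) ⟩
    ι c (g * 1)                     ∎
    where open ≡-Reasoning
  altSum-geometric (suc d) F g F≡ = begin
    altSum (suc d) F (suc (suc d))
      ≡⟨ altSum-pascal d F (suc d) ⟩
    (altSum d F (suc d) ⊕ s ⊛ natR dualNumbers (d C suc d) ⊛ F (suc d)) ⊕ 𝔻.- altSum d (λ i → F (suc i)) (suc d)
      ≡⟨ cong (λ y → (altSum d F (suc d) ⊕ s ⊛ natR dualNumbers y ⊛ F (suc d)) ⊕ 𝔻.- Y) (k>n⇒nCk≡0 (ℕ.n<1+n d)) ⟩
    (altSum d F (suc d) ⊕ s ⊛ 𝔻.0# ⊛ F (suc d)) ⊕ 𝔻.- altSum d (λ i → F (suc i)) (suc d)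
      ≡⟨ cong (λ y → (altSum d F (suc d) ⊕ y) ⊕ 𝔻.- Y) (trans (cong (_⊛ F (suc d)) (𝔻.zeroʳ s)) (𝔻.zeroˡ (F (suc d)))) ⟩
    (altSum d F (suc d) ⊕ 𝔻.0#) ⊕ 𝔻.- altSum d (λ i → F (suc i)) (suc d)
      ≡⟨ cong₂ (λ y z → y ⊕ 𝔻.- z)
           (trans (𝔻.+-identityʳ _) (altSum-geometric d F (x * g)
             (λ i i≤d → trans (F≡ i (ℕ.m≤n⇒m≤1+n i≤d)) (cong (ι c) (shiftx i i≤d)))))
           (altSum-geometric d (λ i → F (suc i)) g (λ i i≤d → F≡ (suc i) (s≤s i≤d))) ⟩
    ι (δ d) (x * g * k ^ d) ⊕ 𝔻.- ι (δ d) (g * k ^ d)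
      ≡⟨ cong₂ _,_ (ℤ.+-inverseʳ (ℤ.+ δ d)) (trans (cong (λ y → ℤ.+ y ℤ.+ ℤ.- ℤ.+ (g * k ^ d)) (step k g (k ^ d))) (cancel (g * (k * k ^ d)) (g * k ^ d))) ⟩
    ι 0 (g * (k * k ^ d)) ∎
    where
    open ≡-Reasoning
    s = signR dualNumbers (suc d)
    Y = altSum d (λ i → F (suc i)) (suc d)
    shiftx : ∀ i → i ≤ d → x ^ (suc d ∸ i) * g ≡ x ^ (d ∸ i) * (x * g)
    shiftx i i≤d = trans (cong (λ e → x ^ e * g) (ℕ.+-∸-assoc 1 i≤d)) (perm x (x ^ (d ∸ i)) g)
      where
      perm : ∀ x E g → x * E * g ≡ E * (x * g)
      perm = ℕ.solve-∀
    step : ∀ k g K → suc k * g * K ≡ g * (k * K) + g * K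
    step = ℕ.solve-∀
    cancel : ∀ a b → ℤ.+ (a + b) ℤ.+ ℤ.- ℤ.+ b ≡ ℤ.+ a
    cancel a b = trans (ℤ.+-assoc (ℤ.+ a) (ℤ.+ b) (ℤ.- ℤ.+ b)) (trans (cong (λ y → ℤ.+ a ℤ.+ y) (ℤ.+-inverseʳ (ℤ.+ b))) (ℤ.+-identityʳ (ℤ.+ a)))

  powR-1 : ∀ i → powR dualNumbers 𝔻.1# i ≡ 𝔻.1#
  powR-1 zero    = refl
  powR-1 (suc i) = trans (𝔻.*-identityˡ _) (powR-1 i)

  Dbullet-altSum : ∀ w d n →
    ΣR dualNumbers (map (λ i → signR dualNumbers i ⊛ natR dualNumbers (d C i) ⊛ ζ (w ∸ i , 0) ⊛ powR dualNumbers 𝔻.1# i) (upTo n))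
    ≡ altSum d (λ i → ζ (w ∸ i , 0)) n
  Dbullet-altSum w d zero = refl
  Dbullet-altSum w d (suc n) = begin
    ΣR dualNumbers (map f (upTo (suc n)))             ≡⟨ cong (λ l → ΣR dualNumbers (map f l)) (upTo-∷ʳ n) ⟨
    ΣR dualNumbers (map f (upTo n ++ [ n ]))          ≡⟨ cong (ΣR dualNumbers) (map-++ f (upTo n) [ n ]) ⟩
    ΣR dualNumbers (map f (upTo n) ++ [ f n ])        ≡⟨ ΣR-∷ʳ dualNumbers (map f (upTo n)) (f n) ⟩
    ΣR dualNumbers (map f (upTo n)) ⊕ f n             ≡⟨ cong₂ _⊕_ (Dbullet-altSum w d n)
                                                          (trans (cong (t ⊛_) (powR-1 n)) (𝔻.*-identityʳ t)) ⟩
    altSum d (λ i → ζ (w ∸ i , 0)) (suc n)            ∎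
    where
    open ≡-Reasoning
    t = signR dualNumbers n ⊛ natR dualNumbers (d C n) ⊛ ζ (w ∸ n , 0)
    f : ℕ → ℤ × ℤ
    f i = signR dualNumbers i ⊛ natR dualNumbers (d C i) ⊛ ζ (w ∸ i , 0) ⊛ powR dualNumbers 𝔻.1# i

  -- A component of `d + 1` vertices with weights at least 2 and total excess `τ` over 2 has weight
  -- `d + (2 + (d + τ))`. In this form `w ∸ i` is visibly at least 2 for `i ≤ d`, so `ζ` follows its
  -- geometric clause.
  Dbullet-value : ∀ d τ → Dbullet dualNumbers ζ (d + (2 + (d + τ)) , d) ≡ ι (δ d) (x ^ (2 + (d + τ)) * k ^ d)
  Dbullet-value d τ = trans (Dbullet-altSum w d (suc d))
    (altSum-geometric d (λ i → ζ (w ∸ i , 0)) (x ^ (2 + (d + τ))) λ i i≤d →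
      trans (cong (λ y → ζ (y , 0)) (exponent i i≤d)) (cong (ι c) (power i)))
    where
    w = d + (2 + (d + τ))
    exponent : ∀ i → i ≤ d → w ∸ i ≡ 2 + (d ∸ i + (d + τ))
    exponent i i≤d = trans (ℕ.+-∸-comm (2 + (d + τ)) i≤d) (perm (d ∸ i) (d + τ))
      where
      perm : ∀ e y → e + (2 + y) ≡ 2 + (e + y)
      perm = ℕ.solve-∀
    power : ∀ i → x ^ (2 + (d ∸ i + (d + τ))) ≡ x ^ (d ∸ i) * x ^ (2 + (d + τ))
    power i = trans (cong (λ y → x * (x * y)) (ℕ.^-distribˡ-+-* x (d ∸ i) (d + τ)))
                    (perm x (x ^ (d ∸ i)) (x ^ (d + τ)))
      where
      perm : ∀ x E Y → x * (x * (E * Y)) ≡ E * (x * (x * Y))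
      perm = ℕ.solve-∀

  -- The value of D on a component of `suc d` vertices whose weights exceed 2 by `τ` in total.
  bullet : ℕ → ℕ → ℤ × ℤ
  bullet d τ = ι (δ d) (x ^ (2 + (d + τ)) * k ^ d)

  singles : List ℕ → ℤ × ℤ
  singles U = ΠR dualNumbers (map (bullet 0) U)

  -- The ε-coefficient of `singles`, by the product rule.
  dsingles : List ℕ → ℕ
  dsingles []      = 0
  dsingles (a ∷ A) = c * dsingles A + x ^ (2 + a) * c ^ length A

  singles-value : ∀ A → singles A ≡ ι (c ^ length A) (dsingles A)
  singles-value []      = refl
  singles-value (a ∷ A) = trans (cong (bullet 0 a ⊛_) (singles-value A))
    (trans (ι-⊛ c (x ^ (2 + a) * 1) (c ^ length A) (dsingles A))
      (cong (λ y → ι (c * c ^ length A) (c * dsingles A + y * c ^ length A)) (ℕ.*-identityʳ (x ^ (2 + a)))))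

  -- A leaf left alone gives its real part `c`; a leaf joined to the component that carries ε gives
  -- one more `k` and `suc a` more factors `x`.
  attach : List ℕ → ℕ
  attach A = product (map (λ a → c + k * x ^ suc a) A)

  -- Here `d` and `τ` describe the core, namely the vertices joined so far. When the core carries ε,
  -- every lone leaf contributes its real part, which gives `attach A`. Only a core of one vertex
  -- with no leaf joined has a nonzero real part; then ε may sit on a lone leaf instead, which gives
  -- `dsingles A`.
  starSum : ∀ A d τ →
    Σsplit dualNumbers A (λ S U → singles U ⊛ bullet (d + length S) (τ + sum S))
    ≡ ι (δ d * c ^ length A) (δ d * dsingles A + x ^ (2 + (d + τ)) * k ^ d * attach A)
  starSum [] d τ = trans (𝔻.*-identityˡ (bullet (d + 0) (τ + 0)))
    (trans (cong₂ bullet (ℕ.+-identityʳ d) (ℕ.+-identityʳ τ))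
      (cong₂ ι (sym (ℕ.*-identityʳ (δ d))) (step (δ d) (x ^ (2 + (d + τ)) * k ^ d))))
    where
    step : ∀ D G → G ≡ D * 0 + G * 1
    step = ℕ.solve-∀
  starSum (a ∷ A) d τ = begin
    Σsplit dualNumbers A (λ S U → bullet 0 a ⊛ singles U ⊛ bullet (d + length S) (τ + sum S))
    ⊕ Σsplit dualNumbers A (λ S U → singles U ⊛ bullet (d + suc (length S)) (τ + (a + sum S)))
      ≡⟨ cong₂ _⊕_
          (trans (Σsplit-cong dualNumbers A (λ S U → 𝔻.*-assoc (bullet 0 a) (singles U) (bullet (d + length S) (τ + sum S))))
            (Σsplit-*ˡ dualNumbers (bullet 0 a) A (λ S U → singles U ⊛ bullet (d + length S) (τ + sum S))))
          (Σsplit-cong dualNumbers A (λ S U → cong (singles U ⊛_)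
            (cong₂ bullet (ℕ.+-suc d (length S)) (sym (ℕ.+-assoc τ a (sum S)))))) ⟩
    bullet 0 a ⊛ Σsplit dualNumbers A (λ S U → singles U ⊛ bullet (d + length S) (τ + sum S))
    ⊕ Σsplit dualNumbers A (λ S U → singles U ⊛ bullet (suc d + length S) (τ + a + sum S))
      ≡⟨ cong₂ (λ y z → bullet 0 a ⊛ y ⊕ z) (starSum A d τ) (starSum A (suc d) (τ + a)) ⟩
    bullet 0 a ⊛ ι (δ d * c ^ length A) (δ d * dsingles A + g * attach A)
    ⊕ ι 0 (g' * attach A)
      ≡⟨ cong (_⊕ ι 0 (g' * attach A)) (ι-⊛ c (x ^ (2 + a) * 1) (δ d * c ^ length A) (δ d * dsingles A + g * attach A)) ⟩
    ι (c * (δ d * c ^ length A) + 0)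
      (c * (δ d * dsingles A + g * attach A) + x ^ (2 + a) * 1 * (δ d * c ^ length A) + g' * attach A)
      ≡⟨ cong₂ ι (fst c (δ d) (c ^ length A))
          (trans (cong (λ y → c * (δ d * dsingles A + g * attach A)
                     + x ^ (2 + a) * 1 * (δ d * c ^ length A) + y * attach A) g'≡)
            (snd c (δ d) (dsingles A) g (attach A) (x ^ (2 + a)) (c ^ length A) k (x ^ suc a))) ⟩
    ι (δ d * (c * c ^ length A))
      (δ d * (c * dsingles A + x ^ (2 + a) * c ^ length A) + g * ((c + k * x ^ suc a) * attach A)) ∎
    where
    open ≡-Reasoning
    g  = x ^ (2 + (d + τ)) * k ^ d
    g' = x ^ (2 + (suc d + (τ + a))) * k ^ suc d
    g'≡ : g' ≡ g * (k * x ^ suc a)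
    g'≡ = trans (cong (λ e → x ^ e * k ^ suc d) (exponent d τ a))
      (trans (cong (_* k ^ suc d) (ℕ.^-distribˡ-+-* x (2 + (d + τ)) (suc a)))
        (perm (x ^ (2 + (d + τ))) (x ^ suc a) k (k ^ d)))
      where
      exponent : ∀ d τ a → 2 + (suc d + (τ + a)) ≡ 2 + (d + τ) + suc a
      exponent = ℕ.solve-∀
      perm : ∀ E X k K → E * X * (k * K) ≡ E * K * (k * X)
      perm = ℕ.solve-∀
    fst : ∀ c D C → c * (D * C) + 0 ≡ D * (c * C)
    fst = ℕ.solve-∀
    snd : ∀ c D E g P Y C k X → c * (D * E + g * P) + Y * 1 * (D * C) + g * (k * X) * P
                          ≡ D * (c * E + Y * C) + g * ((c + k * X) * P)
    snd = ℕ.solve-∀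

  -- The two terms in the bracket belong to edge sets without and with the edge between the centres.
  twoStarSum : ℕ → List ℕ → ℕ → List ℕ → ℤ × ℤ
  twoStarSum p A q B = Σsplit dualNumbers A λ S U → Σsplit dualNumbers B λ S' U' →
    singles U ⊛ singles U' ⊛
      (bullet (length S) (p + sum S) ⊛ bullet (length S') (q + sum S')
       ⊕ bullet (suc (length S + length S')) (p + q + (sum S + sum S')))

  -- Without the joining edge the two star sums multiply. With it, the centres form a core of two
  -- vertices to which the leaves of both sides attach.
  twoStarSum-factor : ∀ p A q B → twoStarSum p A q B ≡
    ι (c * c ^ length A) (c * dsingles A + x ^ (2 + p) * 1 * attach A)
    ⊛ ι (c * c ^ length B) (c * dsingles B + x ^ (2 + q) * 1 * attach B)
    ⊕ ι (attach B) 0 ⊛ ι 0 (x ^ (3 + (p + q)) * (k * 1) * attach A)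
  twoStarSum-factor p A q B = begin
    twoStarSum p A q B
      ≡⟨ Σsplit-cong dualNumbers A inner ⟩
    Σsplit dualNumbers A (λ S U → starB ⊛ (singles U ⊛ bullet (length S) (p + sum S))
                                  ⊕ b ⊛ (singles U ⊛ bullet (1 + length S) (p + q + sum S)))
      ≡⟨ Σsplit-+ dualNumbers A _ _ ⟩
    Σsplit dualNumbers A (λ S U → starB ⊛ (singles U ⊛ bullet (length S) (p + sum S)))
    ⊕ Σsplit dualNumbers A (λ S U → b ⊛ (singles U ⊛ bullet (1 + length S) (p + q + sum S)))
      ≡⟨ cong₂ _⊕_ (Σsplit-*ˡ dualNumbers starB A _) (Σsplit-*ˡ dualNumbers b A _) ⟩
    starB ⊛ Σsplit dualNumbers A (λ S U → singles U ⊛ bullet (length S) (p + sum S))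
    ⊕ b ⊛ Σsplit dualNumbers A (λ S U → singles U ⊛ bullet (1 + length S) (p + q + sum S))
      ≡⟨ cong₂ (λ y z → starB ⊛ y ⊕ b ⊛ z) (starSum A 0 p) (starSum A 1 (p + q)) ⟩
    starB ⊛ starA ⊕ b ⊛ joined
      ≡⟨ cong (_⊕ b ⊛ joined) (𝔻.*-comm starB starA) ⟩
    starA ⊛ starB ⊕ b ⊛ joined ∎
    where
    open ≡-Reasoning
    starA = ι (c * c ^ length A) (c * dsingles A + x ^ (2 + p) * 1 * attach A)
    starB = ι (c * c ^ length B) (c * dsingles B + x ^ (2 + q) * 1 * attach B)
    joined = ι 0 (x ^ (3 + (p + q)) * (k * 1) * attach A)
    b = ι (attach B) 0
    rearrange : ∀ u u' e e' f → u ⊛ u' ⊛ (e ⊛ e' ⊕ f) ≡ u ⊛ e ⊛ (u' ⊛ e') ⊕ u ⊛ (u' ⊛ f)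
    rearrange (u , v) (u' , v') (e , g) (e' , g') (f , h) = cong₂ _,_ (fst u u' e e' f) (snd u v u' v' e g e' g' f h)
      where
      fst : ∀ u u' e e' f → u ℤ.* u' ℤ.* (e ℤ.* e' ℤ.+ f) ≡ u ℤ.* e ℤ.* (u' ℤ.* e') ℤ.+ u ℤ.* (u' ℤ.* f)
      fst = ℤ.solve-∀
      snd : ∀ u v u' v' e g e' g' f h →
        u ℤ.* u' ℤ.* (e ℤ.* g' ℤ.+ g ℤ.* e' ℤ.+ h) ℤ.+ (u ℤ.* v' ℤ.+ v ℤ.* u') ℤ.* (e ℤ.* e' ℤ.+ f)
        ≡ u ℤ.* e ℤ.* (u' ℤ.* g' ℤ.+ v' ℤ.* e') ℤ.+ (u ℤ.* g ℤ.+ v ℤ.* e) ℤ.* (u' ℤ.* e') ℤ.+ (u ℤ.* (u' ℤ.* h ℤ.+ v' ℤ.* f) ℤ.+ v ℤ.* (u' ℤ.* f))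
      snd = ℤ.solve-∀
    -- A core of at least two vertices has real part 0, so summing over the splittings of `B`
    -- multiplies its value by the scalar `attach B`, which does not depend on the selection in `A`.
    absorb : ∀ d τ → ι (δ (suc d) * c ^ length B) (0 + x ^ (2 + (suc d + τ)) * k ^ suc d * attach B)
                     ≡ b ⊛ bullet (suc d) τ
    absorb d τ = sym (trans (ι-⊛ (attach B) 0 0 G) (cong₂ ι (ℕ.*-zeroʳ (attach B)) (step (attach B) G)))
      where
      G = x ^ (2 + (suc d + τ)) * k ^ suc d
      step : ∀ P G → P * G + 0 ≡ 0 + G * P
      step = ℕ.solve-∀
    inner : ∀ S U → Σsplit dualNumbers B (λ S' U' → singles U ⊛ singles U' ⊛
      (bullet (length S) (p + sum S) ⊛ bullet (length S') (q + sum S')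
       ⊕ bullet (suc (length S + length S')) (p + q + (sum S + sum S'))))
      ≡ starB ⊛ (singles U ⊛ bullet (length S) (p + sum S)) ⊕ b ⊛ (singles U ⊛ bullet (1 + length S) (p + q + sum S))
    inner S U = begin
      _ ≡⟨ Σsplit-cong dualNumbers B (λ S' U' → trans
             (rearrange u (singles U') e (bullet (length S') (q + sum S')) (bullet (suc (length S + length S')) (p + q + (sum S + sum S'))))
             (cong (λ y → u ⊛ e ⊛ (singles U' ⊛ bullet (length S') (q + sum S')) ⊕ u ⊛ (singles U' ⊛ bullet (suc (length S + length S')) y))
               (sym (ℕ.+-assoc (p + q) (sum S) (sum S'))))) ⟩
      Σsplit dualNumbers B (λ S' U' → u ⊛ e ⊛ F S' U' ⊕ u ⊛ G S' U')
        ≡⟨ Σsplit-+ dualNumbers B (λ S' U' → u ⊛ e ⊛ F S' U') (λ S' U' → u ⊛ G S' U') ⟩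
      Σsplit dualNumbers B (λ S' U' → u ⊛ e ⊛ F S' U') ⊕ Σsplit dualNumbers B (λ S' U' → u ⊛ G S' U')
        ≡⟨ cong₂ _⊕_ (Σsplit-*ˡ dualNumbers (u ⊛ e) B F) (Σsplit-*ˡ dualNumbers u B G) ⟩
      u ⊛ e ⊛ Σsplit dualNumbers B F ⊕ u ⊛ Σsplit dualNumbers B G
        ≡⟨ cong₂ (λ y z → u ⊛ e ⊛ y ⊕ u ⊛ z) (starSum B 0 q)
             (trans (starSum B (suc (length S)) (p + q + sum S)) (absorb (length S) (p + q + sum S))) ⟩
      u ⊛ e ⊛ starB ⊕ u ⊛ (b ⊛ f)
        ≡⟨ cong₂ _⊕_ (𝔻.*-comm (u ⊛ e) starB)
             (trans (sym (𝔻.*-assoc u b f)) (trans (cong (_⊛ f) (𝔻.*-comm u b)) (𝔻.*-assoc b u f))) ⟩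
      starB ⊛ (u ⊛ e) ⊕ b ⊛ (u ⊛ f) ∎
      where
      u = singles U
      e = bullet (length S) (p + sum S)
      f = bullet (1 + length S) (p + q + sum S)
      F G : List ℕ → List ℕ → ℤ × ℤ
      F S' U' = singles U' ⊛ bullet (length S') (q + sum S')
      G S' U' = singles U' ⊛ bullet (suc (length S) + length S') (p + q + sum S + sum S')

  -- This is why the constant is `c = k * m`: every factor then contains `k`.
  attach-leafProduct : ∀ A → attach A ≡ k ^ length A * leafProduct x m A
  attach-leafProduct []      = refl
  attach-leafProduct (a ∷ A) = trans (cong ((c + k * x ^ suc a) *_) (attach-leafProduct A))
    (step k m (x ^ suc a) (k ^ length A) (leafProduct x m A))
    where
    step : ∀ k m X K P → (k * m + k * X) * (K * P) ≡ k * K * ((m + X) * P)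
    step = ℕ.solve-∀

  -- Multiplying by `c` avoids the exponent `length A ∸ 1`.
  dsingles-leafSum : ∀ A → c * dsingles A ≡ c ^ length A * (x * leafSum x A)
  dsingles-leafSum []      = trans (ℕ.*-zeroʳ c) (sym (trans (ℕ.*-identityˡ (x * 0)) (ℕ.*-zeroʳ x)))
  dsingles-leafSum (a ∷ A) = trans (cong (λ y → c * (y + x ^ (2 + a) * c ^ length A)) (dsingles-leafSum A))
    (step c (c ^ length A) x (leafSum x A) (x ^ suc a))
    where
    step : ∀ c C x L X → c * (C * (x * L) + x * X * C) ≡ c * C * (x * (X + L))
    step = ℕ.solve-∀

  twoStarSum-value : ∀ p A q B → twoStarSum p A q B ≡
    ι (c ^ (2 + (length A + length B)))
      (k ^ (1 + (length A + length B)) * (x * subtreePoly x m p A q B))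
  twoStarSum-value p A q B = trans (twoStarSum-factor p A q B)
    (trans (cong₂ _⊕_
        (ι-⊛ (c * c ^ length A) (c * dsingles A + x ^ (2 + p) * 1 * attach A)
             (c * c ^ length B) (c * dsingles B + x ^ (2 + q) * 1 * attach B))
        (ι-⊛ (attach B) 0 0 (x ^ (3 + (p + q)) * (k * 1) * attach A)))
      (cong₂ ι fst snd))
    where
    α = length A
    β = length B
    perm : ∀ c C D P → c * C * (c * D) + P * 0 ≡ c * (c * (C * D))
    perm = ℕ.solve-∀
    fst : c * c ^ α * (c * c ^ β) + attach B * 0 ≡ c ^ (2 + (α + β))
    fst = trans (perm c (c ^ α) (c ^ β) (attach B)) (cong (λ y → c * (c * y)) (sym (ℕ.^-distribˡ-+-* c α β)))
    X = x ^ suc p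
    Y = x ^ suc q
    step : ∀ k m x X Y KA MA KB MB SA SB PA PB →
      k * m * (KA * MA) * (KB * MB * (x * SB) + x * Y * 1 * (KB * PB))
      + (KA * MA * (x * SA) + x * X * 1 * (KA * PA)) * (k * m * (KB * MB))
      + (KB * PB * (x * (X * Y) * (k * 1) * (KA * PA)) + 0 * 0)
      ≡ k * (KA * KB) * (x * (m * (MA * MB) * (SA + SB)
          + (m * MB * (X * PA) + m * MA * (Y * PB)) + X * Y * (PA * PB)))
    step = ℕ.solve-∀
    x^ : x ^ (3 + (p + q)) ≡ x * (X * Y)
    x^ = trans (cong (λ e → x * x ^ e) (cong suc (sym (ℕ.+-suc p q)))) (cong (x *_) (ℕ.^-distribˡ-+-* x (suc p) (suc q)))
    km^ : ∀ n → c ^ n ≡ k ^ n * m ^ n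
    km^ zero    = refl
    km^ (suc n) = trans (cong (c *_) (km^ n)) (perm' k m (k ^ n) (m ^ n))
      where
      perm' : ∀ k m K M → k * m * (K * M) ≡ k * K * (m * M)
      perm' = ℕ.solve-∀
    dsingles' : ∀ A → c * dsingles A ≡ k ^ length A * m ^ length A * (x * leafSum x A)
    dsingles' A = trans (dsingles-leafSum A) (cong (_* (x * leafSum x A)) (km^ (length A)))
    snd : c * c ^ α * (c * dsingles B + x * Y * 1 * attach B)
          + (c * dsingles A + x * X * 1 * attach A) * (c * c ^ β)
          + (attach B * (x ^ (3 + (p + q)) * (k * 1) * attach A) + 0 * 0)
          ≡ k ^ (1 + (α + β)) * (x * subtreePoly x m p A q B)
    snd rewrite dsingles' A | dsingles' B | attach-leafProduct A | attach-leafProduct B | km^ α | km^ β | x^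
        | ℕ.^-distribˡ-+-* k α β | ℕ.^-distribˡ-+-* m α β
        | trans (cong sum (map-++ (λ a → x ^ suc a) A B)) (sum-++ (map (λ a → x ^ suc a) A) (map (λ a → x ^ suc a) B))
        | trans (cong product (map-++ (λ a → m + x ^ suc a) A B)) (product-++ (map (λ a → m + x ^ suc a) A) (map (λ a → m + x ^ suc a) B))
      = step k m x X Y (k ^ α) (m ^ α) (k ^ β) (m ^ β) (leafSum x A) (leafSum x B) (leafProduct x m A) (leafProduct x m B)

-- Components of an edge set

unique-↭ : ∀ {A : Set} {xs ys : List A} → Unique xs → Unique ys →
           (∀ {x} → x ∈ xs → x ∈ ys) → (∀ {x} → x ∈ ys → x ∈ xs) → xs ↭ ys
unique-↭ !xs !ys xs⊆ys ys⊆xs = ∼bag⇒↭ (unique∧set⇒bag !xs !ys (mk⇔ xs⊆ys ys⊆xs))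

¬T⇒Tnot : ∀ {b} → ¬ T b → T (not b)
¬T⇒Tnot {false} _  = _
¬T⇒Tnot {true}  ¬t = ¬t _

Tnot⇒¬T : ∀ {b} → T (not b) → ¬ T b
Tnot⇒¬T {false} _ ()

module _ {n : ℕ} (A : List (Fin n × Fin n)) where

  Adjacent : Fin n → Fin n → Set
  Adjacent u v = (u , v) ∈ A ⊎ (v , u) ∈ A

  adjacent-sym : ∀ {u v} → Adjacent u v → Adjacent v u
  adjacent-sym (inj₁ e) = inj₂ e
  adjacent-sym (inj₂ e) = inj₁ e

  adjA⁺ : ∀ {u v} → Adjacent u v → T (adjA A u v)
  adjA⁺ {u} {v} (inj₁ e) = any⁺ _ (lose e (from T-∨ (inj₁ (from T-∧ (fromWitness {a? = u ≟ u} refl , fromWitness {a? = v ≟ v} refl)))))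
  adjA⁺ {u} {v} (inj₂ e) = any⁺ _ (lose e (from T-∨ (inj₂ (from T-∧ (fromWitness {a? = v ≟ v} refl , fromWitness {a? = u ≟ u} refl)))))

  adjA⁻ : ∀ {u v} → T (adjA A u v) → Adjacent u v
  adjA⁻ {u} {v} t with find (any⁻ _ A t)
  ... | (a , b) , e , s with to T-∨ s
  ...   | inj₁ s₁ with to T-∧ s₁
  ...     | p , q with toWitness {a? = a ≟ u} p | toWitness {a? = b ≟ v} q
  ...       | refl | refl = inj₁ e
  adjA⁻ {u} {v} t | (a , b) , e , s | inj₂ s₂ with to T-∧ s₂
  ...     | p , q with toWitness {a? = a ≟ v} p | toWitness {a? = b ≟ u} q
  ...       | refl | refl = inj₂ e

  -- The index only bounds the length, since `stop` is available at every `k`; this matches `reach`.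
  data Walk : ℕ → Fin n → Fin n → Set where
    stop : ∀ {k u} → Walk k u u
    extend : ∀ {k u v w} → Walk k u v → Adjacent v w → Walk (suc k) u w

  weaken : ∀ {j k u v} → j ≤ k → Walk j u v → Walk k u v
  weaken j≤k       stop       = stop
  weaken (s≤s j≤k) (extend p e) = extend (weaken j≤k p) e

  append : ∀ {j k u v w} → Walk j u v → Walk k v w → Walk (k + j) u w
  append {j} {k} p stop = weaken (ℕ.m≤n+m j k) p
  append p (extend q e) = extend (append p q) e

  reach⁺ : ∀ {k u v} → Walk k u v → T (reach A k u v)
  reach⁺ {zero}  {u} stop = fromWitness {a? = u ≟ u} refl
  reach⁺ {suc k} {u} stop = from T-∨ (inj₁ (reach⁺ {k} {u} stop))
  reach⁺ (extend {v = v} p e) = from T-∨ (inj₂ (any⁺ _ (lose (∈-allFin v) (from T-∧ (reach⁺ p , adjA⁺ e)))))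

  reach⁻ : ∀ k {u v} → T (reach A k u v) → Walk k u v
  reach⁻ zero {u} {v} t with toWitness {a? = u ≟ v} t
  ... | refl = stop
  reach⁻ (suc k) t with to T-∨ t
  ... | inj₁ s = weaken (ℕ.n≤1+n k) (reach⁻ k s)
  ... | inj₂ s with find (any⁻ _ (allFin n) s)
  ...   | w , _ , s' with to T-∧ s'
  ...     | p , q = extend (reach⁻ k p) (adjA⁻ q)

  -- The vertices of one component. The bound `n` on the walks is the fuel of `conn`; blocks are
  -- exhibited with short walks, so that no walk ever has to be shortened.
  record Block (B : List (Fin n)) : Set where
    field
      inhabited : ∃ (_∈ B)
      unique    : Unique B
      closed    : ∀ {u v} → Adjacent u v → u ∈ B → v ∈ B
      connected : ∀ {u v} → u ∈ B → v ∈ B → Walk n u v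

    stays : ∀ {k u v} → Walk k u v → u ∈ B → v ∈ B
    stays stop       u∈ = u∈
    stays (extend p e) u∈ = closed e (stays p u∈)

    comes : ∀ {k u v} → Walk k u v → v ∈ B → u ∈ B
    comes stop       v∈ = v∈
    comes (extend p e) v∈ = comes p (closed (adjacent-sym e) v∈)

  least : ∀ v (B : List (Fin n)) → ∃ λ r → r ∈ v ∷ B × (∀ {u} → u ∈ v ∷ B → toℕ r ≤ toℕ u)
  least v [] = v , here refl , λ { (here refl) → ℕ.≤-refl }
  least v (w ∷ B) with least w B
  ... | r , r∈ , r≤ with ℕ.≤-total (toℕ v) (toℕ r)
  ...   | inj₁ v≤r = v , here refl , λ { (here refl) → ℕ.≤-refl ; (there u∈) → ℕ.≤-trans v≤r (r≤ u∈) }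
  ...   | inj₂ r≤v = r , there r∈ , λ { (here refl) → r≤v ; (there u∈) → r≤ u∈ }

  least-of : ∀ {B} → ∃ (_∈ B) → ∃ λ r → r ∈ B × (∀ {u} → u ∈ B → toℕ r ≤ toℕ u)
  least-of {v ∷ B} _ = least v B

  isRep⁺ : ∀ {v} → (∀ {u} → Walk n u v → toℕ v ≤ toℕ u) → T (isRep A v)
  isRep⁺ {v} min = ¬T⇒Tnot λ t → let u , _ , s = find (any⁻ _ (allFin n) t) ; u<v , c = to T-∧ s in
    ℕ.<⇒≱ (ℕ.<ᵇ⇒< (toℕ u) (toℕ v) u<v) (min (reach⁻ n c))

  isRep⁻ : ∀ {u v} → T (isRep A v) → Walk n u v → toℕ v ≤ toℕ u
  isRep⁻ {u} {v} t p = ℕ.≮⇒≥ λ u<v →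
    Tnot⇒¬T t (any⁺ _ (lose (∈-allFin u) (from T-∧ (ℕ.<⇒<ᵇ u<v , reach⁺ p))))

  -- The vertices of a block reach one another and no others, so `isRep` keeps only the one of least
  -- index.
  block-representative : ∀ {B} → Block B → ∃ λ r → r ∈ B × filterᵇ (isRep A) B ≡ [ r ]
  block-representative {B} block with least-of (Block.inhabited block)
  ... | r , r∈ , r≤ = r , r∈ , ↭-singleton-inv (unique-↭ (Unique.filter⁺ (T? ∘ isRep A) unique) ([] ∷ [])
      (λ v∈f → let v∈ , t = ∈-filter⁻ (T? ∘ isRep A) v∈f in
        here (toℕ-injective (ℕ.≤-antisym (isRep⁻ t (connected r∈ v∈)) (r≤ v∈))))
      λ { (here refl) → ∈-filter⁺ (T? ∘ isRep A) r∈ (isRep⁺ λ p → r≤ (comes p r∈)) })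
    where open Block block

  component-block : ∀ {B v} → Block B → v ∈ B →
    v ∷ filterᵇ (λ u → conn A v u ∧ not (u == v)) (allFin n) ↭ B
  component-block {B} {v} block v∈ = unique-↭
    (All.tabulate (λ {u} u∈f v≡u → Tnot⇒¬T (proj₂ (to T-∧ (proj₂ (∈-filter⁻ P? {xs = allFin n} u∈f)))) (fromWitness {a? = u ≟ v} (sym v≡u)))
      ∷ Unique.filter⁺ P? (Unique.allFin⁺ n))
    unique
    (λ { (here refl) → v∈
       ; (there u∈f) → stays (reach⁻ n (proj₁ (to T-∧ (proj₂ (∈-filter⁻ P? {xs = allFin n} u∈f))))) v∈ })
    into
    where
    open Block block
    P? = T? ∘ λ u → conn A v u ∧ not (u == v)
    into : ∀ {u} → u ∈ B → u ∈ v ∷ filterᵇ (λ u → conn A v u ∧ not (u == v)) (allFin n)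
    into {u} u∈ with u ≟ v
    ... | yes refl = here refl
    ... | no  u≢v  = there (∈-filter⁺ P? (∈-allFin u)
                       (from T-∧ (reach⁺ (connected v∈ u∈) , ¬T⇒Tnot λ t → u≢v (toWitness {a? = u ≟ v} t))))

-- Every `∔` adds 1 to the second entry, and a component with `l` vertices takes `l - 1` of them.
blockMark : ∀ {n} → (Fin n → ℕ) → List (Fin n) → Mark
blockMark ω B = sum (map ω B) , pred (length B)

dotSumList-markOf : ∀ {n} (ω : Fin n → ℕ) v us →
  dotSumList (markOf ω v) (map (markOf ω) us) ≡ blockMark ω (v ∷ us)
dotSumList-markOf ω v []       = cong (_, 0) (sym (ℕ.+-identityʳ (ω v)))
dotSumList-markOf ω v (u ∷ us) = cong (markOf ω v ∔_) (dotSumList-markOf ω u us)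

compMark-block : ∀ {n} (ω : Fin n → ℕ) {A B v} → Block A B → v ∈ B → compMark (markOf ω) A v ≡ blockMark ω B
compMark-block ω block v∈ = trans (dotSumList-markOf ω _ _)
  (cong₂ (λ s l → s , pred l) (sum-↭ (map⁺ ω p)) (↭-length p))
  where p = component-block _ block v∈

filterᵇ-cong : ∀ {A : Set} {p q : A → Bool} → (∀ x → p x ≡ q x) → ∀ xs → filterᵇ p xs ≡ filterᵇ q xs
filterᵇ-cong p≡q [] = refl
filterᵇ-cong {p = p} {q} p≡q (x ∷ xs) with p x | q x | p≡q x
... | true  | true  | refl = cong (x ∷_) (filterᵇ-cong p≡q xs)
... | false | false | refl = filterᵇ-cong p≡q xs

any-cong : ∀ {A : Set} {p q : A → Bool} → (∀ x → p x ≡ q x) → ∀ xs → any p xs ≡ any q xs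
any-cong p≡q []       = refl
any-cong p≡q (x ∷ xs) = cong₂ _∨_ (p≡q x) (any-cong p≡q xs)

any-↭ : ∀ {A : Set} (p : A → Bool) {xs ys} → xs ↭ ys → any p xs ≡ any p ys
any-↭ p refl         = refl
any-↭ p (prep x s)   = cong (p x ∨_) (any-↭ p s)
any-↭ p (swap {xs} {ys} x y s) = begin
  p x ∨ (p y ∨ any p xs)  ≡⟨ ∨-assoc (p x) (p y) _ ⟨
  (p x ∨ p y) ∨ any p xs  ≡⟨ cong₂ _∨_ (∨-comm (p x) (p y)) (any-↭ p s) ⟩
  (p y ∨ p x) ∨ any p ys  ≡⟨ ∨-assoc (p y) (p x) _ ⟩
  p y ∨ (p x ∨ any p ys)  ∎
  where open ≡-Reasoning
any-↭ p (Perm.trans s t)  = trans (any-↭ p s) (any-↭ p t)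

-- `edges` puts the end of smaller index first, whereas the numbering of centres and leaves in an
-- arbitrary 2-star is unknown.
normalise : ∀ {n} → Fin n × Fin n → Fin n × Fin n
normalise (u , v) = if toℕ u <ᵇ toℕ v then (u , v) else (v , u)

-- Sums over edge sets and the terms of M

module _ (R : CommutativeRing 0ℓ 0ℓ) where
  open CommutativeRing R using
    (Carrier; _≈_; setoid; +-cong; +-congˡ; +-comm; +-assoc; +-identityˡ; +-identityʳ; *-cong; *-congˡ; *-comm; *-assoc; *-identityˡ)
    renaming (_+_ to _⊹_; _*_ to _·_; refl to ≈-refl; sym to ≈-sym; trans to ≈-trans; reflexive to ≈-reflexive)
  open import Relation.Binary.Reasoning.Setoid setoid

  ΣR-++ : ∀ xs ys → ΣR R (xs ++ ys) ≈ ΣR R xs ⊹ ΣR R ys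
  ΣR-++ []       ys = ≈-sym (+-identityˡ _)
  ΣR-++ (x ∷ xs) ys = ≈-trans (+-congˡ (ΣR-++ xs ys)) (≈-sym (+-assoc x _ _))

  ΠR-++ : ∀ xs ys → ΠR R (xs ++ ys) ≈ ΠR R xs · ΠR R ys
  ΠR-++ []       ys = ≈-sym (*-identityˡ _)
  ΠR-++ (x ∷ xs) ys = ≈-trans (*-congˡ (ΠR-++ xs ys)) (≈-sym (*-assoc x _ _))

  ΠR-↭ : ∀ {xs ys} → xs ↭ ys → ΠR R xs ≈ ΠR R ys
  ΠR-↭ refl        = ≈-refl
  ΠR-↭ (prep x p)  = *-congˡ (ΠR-↭ p)
  ΠR-↭ (swap {xs} {ys} x y p) = begin
    x · (y · ΠR R xs)  ≈⟨ *-assoc x y _ ⟨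
    (x · y) · ΠR R xs  ≈⟨ *-cong (*-comm x y) (ΠR-↭ p) ⟩
    (y · x) · ΠR R ys  ≈⟨ *-assoc y x _ ⟩
    y · (x · ΠR R ys)  ∎
  ΠR-↭ (Perm.trans p q) = ≈-trans (ΠR-↭ p) (ΠR-↭ q)

  Σsub : ∀ {X : Set} → List X → (List X → Carrier) → Carrier
  Σsub []       g = g []
  Σsub (x ∷ xs) g = Σsub xs g ⊹ Σsub xs (g ∘ (x ∷_))

  ΣR-subsets : ∀ {X : Set} (xs : List X) g → ΣR R (map g (subsets xs)) ≈ Σsub xs g
  ΣR-subsets []       g = +-identityʳ _
  ΣR-subsets (x ∷ xs) g = begin
    ΣR R (map g (subsets xs ++ map (x ∷_) (subsets xs)))
      ≡⟨ cong (ΣR R) (trans (map-++ g (subsets xs) _) (cong (map g (subsets xs) ++_) (sym (map-∘ (subsets xs))))) ⟩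
    ΣR R (map g (subsets xs) ++ map (g ∘ (x ∷_)) (subsets xs))
      ≈⟨ ΣR-++ (map g (subsets xs)) _ ⟩
    ΣR R (map g (subsets xs)) ⊹ ΣR R (map (g ∘ (x ∷_)) (subsets xs))
      ≈⟨ +-cong (ΣR-subsets xs g) (ΣR-subsets xs (g ∘ (x ∷_))) ⟩
    Σsub xs g ⊹ Σsub xs (g ∘ (x ∷_)) ∎

  Σsub-cong : ∀ {X : Set} (xs : List X) {f g} → (∀ S → f S ≈ g S) → Σsub xs f ≈ Σsub xs g
  Σsub-cong []       f≈g = f≈g []
  Σsub-cong (x ∷ xs) f≈g = +-cong (Σsub-cong xs f≈g) (Σsub-cong xs (f≈g ∘ (x ∷_)))

  Σsub-↭ : ∀ {X : Set} {xs ys : List X} → xs ↭ ys → ∀ g → (∀ {S S'} → S ↭ S' → g S ≈ g S') → Σsub xs g ≈ Σsub ys g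
  Σsub-↭ refl g resp = ≈-refl
  Σsub-↭ (prep x p) g resp = +-cong (Σsub-↭ p g resp) (Σsub-↭ p (g ∘ (x ∷_)) (resp ∘ prep x))
  Σsub-↭ (swap {xs} {ys} x y p) g resp = begin
    (a ⊹ b) ⊹ (c ⊹ d)      ≈⟨ +-assoc a b (c ⊹ d) ⟩
    a ⊹ (b ⊹ (c ⊹ d))      ≈⟨ +-congˡ (≈-trans (≈-sym (+-assoc b c d)) (≈-trans (+-cong (+-comm b c) ≈-refl) (+-assoc c b d))) ⟩
    a ⊹ (c ⊹ (b ⊹ d))      ≈⟨ +-assoc a c (b ⊹ d) ⟨
    (a ⊹ c) ⊹ (b ⊹ d)      ≈⟨ +-cong (+-cong (Σsub-↭ p g resp) (Σsub-↭ p (g ∘ (x ∷_)) (resp ∘ prep x)))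
                                (+-cong (Σsub-↭ p (g ∘ (y ∷_)) (resp ∘ prep y))
                                  (≈-trans (Σsub-cong xs (λ _ → resp (swap x y ↭-refl)))
                                    (Σsub-↭ p (g ∘ λ S → y ∷ x ∷ S) (resp ∘ prep y ∘ prep x)))) ⟩
    _                      ∎
    where
    a = Σsub xs g
    b = Σsub xs (g ∘ (y ∷_))
    c = Σsub xs (g ∘ (x ∷_))
    d = Σsub xs (g ∘ λ S → x ∷ y ∷ S)
  Σsub-↭ (Perm.trans p q) g resp = ≈-trans (Σsub-↭ p g resp) (Σsub-↭ q g resp)

  Σsub-map : ∀ {X Y : Set} (f : X → Y) xs g → Σsub (map f xs) g ≡ Σsub xs (g ∘ map f)
  Σsub-map f []       g = refl
  Σsub-map f (x ∷ xs) g = cong₂ _⊹_ (Σsub-map f xs g) (Σsub-map f xs (g ∘ (f x ∷_)))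

  Σsub-++ : ∀ {X : Set} (xs ys : List X) g → Σsub (xs ++ ys) g ≡ Σsub xs (λ S → Σsub ys (λ S' → g (S ++ S')))
  Σsub-++ []       ys g = refl
  Σsub-++ (x ∷ xs) ys g = cong₂ _⊹_ (Σsub-++ xs ys g) (Σsub-++ xs ys (g ∘ (x ∷_)))

  -- The summands need to be compared only where `S` and `U` partition `xs`; the identification of
  -- the components relies on this.
  Σsub-Σsplit : ∀ {X : Set} (xs : List X) {g f} → (∀ S U → S ++ U ↭ xs → g S ≈ f S U) → Σsub xs g ≈ Σsplit R xs f
  Σsub-Σsplit []       g≈f = g≈f [] [] ↭-refl
  Σsub-Σsplit (x ∷ xs) g≈f = +-cong
    (Σsub-Σsplit xs (λ S U p → g≈f S (x ∷ U) (↭-trans (shift x S U) (prep x p))))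
    (Σsub-Σsplit xs (λ S U p → g≈f (x ∷ S) U (prep x p)))

  module _ {n : ℕ} (ω : Fin n → ℕ) (z : Mark → Carrier) where

    term : List (Fin n × Fin n) → Carrier
    term A = ΠR R (map (λ v → z (compMark (markOf ω) A v)) (filterᵇ (isRep A) (allFin n)))

    -- Commutativity allows the vertices to be listed block by block, and then each block
    -- contributes exactly one representative.
    term-blocks : ∀ A Bs → All (Block A) Bs → concat Bs ↭ allFin n →
      term A ≈ ΠR R (map (λ B → z (blockMark ω B)) Bs)
    term-blocks A Bs blocks p = ≈-trans (ΠR-↭ (map⁺ f (filter-↭ (T? ∘ isRep A) (↭-sym p)))) (go Bs blocks)
      where
      f : Fin n → Carrier
      f v = z (compMark (markOf ω) A v)
      go : ∀ Bs → All (Block A) Bs → ΠR R (map f (filterᵇ (isRep A) (concat Bs))) ≈ ΠR R (map (λ B → z (blockMark ω B)) Bs)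
      go []       []       = ≈-refl
      go (B ∷ Bs) (b ∷ bs) with block-representative A b
      ... | r , r∈ , eq = begin
        ΠR R (map f (filterᵇ (isRep A) (B ++ concat Bs)))
          ≡⟨ cong (ΠR R) (cong (map f) (trans (filter-++ (T? ∘ isRep A) B (concat Bs)) (cong (_++ filterᵇ (isRep A) (concat Bs)) eq))) ⟩
        f r · ΠR R (map f (filterᵇ (isRep A) (concat Bs)))
          ≈⟨ *-cong (≈-reflexive (cong z (compMark-block ω b r∈))) (go Bs bs) ⟩
        z (blockMark ω B) · ΠR R (map (λ B → z (blockMark ω B)) Bs) ∎

    -- Representatives and marks are computed from reachability, hence from `adjA` alone. Edges may
    -- thus be reordered or reversed.
    term-cong : ∀ A A' → (∀ u v → adjA A u v ≡ adjA A' u v) → term A ≡ term A'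
    term-cong A A' adj≡ = cong (ΠR R) (trans
        (map-cong (λ v → cong (λ us → z (dotSumList (markOf ω v) (map (markOf ω) us)))
          (filterᵇ-cong (λ u → cong (_∧ not (u == v)) (reach≡ n v u)) (allFin n))) (filterᵇ (isRep A) (allFin n)))
        (cong (map _) (filterᵇ-cong (λ v → cong not (any-cong (λ u → cong ((toℕ u <ᵇ toℕ v) ∧_) (reach≡ n u v)) (allFin n))) (allFin n))))
      where
      reach≡ : ∀ k u v → reach A k u v ≡ reach A' k u v
      reach≡ zero    u v = refl
      reach≡ (suc k) u v = cong₂ _∨_ (reach≡ k u v) (any-cong (λ w → cong₂ _∧_ (reach≡ k u w) (adj≡ w v)) (allFin n))

    term-↭ : ∀ {A A'} → A ↭ A' → term A ≡ term A'
    term-↭ p = term-cong _ _ λ u v → any-↭ _ p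

    term-normalise : ∀ A → term (map normalise A) ≡ term A
    term-normalise A = term-cong (map normalise A) A (adj≡ A)
      where
      adj≡ : ∀ A u v → adjA (map normalise A) u v ≡ adjA A u v
      adj≡ []            u v = refl
      adj≡ ((a , b) ∷ A) u v with toℕ a <ᵇ toℕ b
      ... | true  = cong (_ ∨_) (adj≡ A u v)
      ... | false = cong₂ _∨_ (trans (∨-comm ((b == u) ∧ (a == v)) ((b == v) ∧ (a == u)))
                      (cong₂ _∨_ (∧-comm (b == v) (a == u)) (∧-comm (b == u) (a == v)))) (adj≡ A u v)

-- The structure of 2-stars

-- (is it a centre?, which of the two stars?)
Role : Set
Role = Bool × Bool

roleAdj : Role → Role → Bool
roleAdj (true  , s) (true  , s') = s xor s'
roleAdj (true  , s) (false , s') = not (s xor s')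
roleAdj (false , s) (true  , s') = not (s xor s')
roleAdj (false , s) (false , s') = false

_≟ᴿ_ : (r r' : Role) → Dec (r ≡ r')
_≟ᴿ_ = ≡-dec Bool._≟_ Bool._≟_

-- A description of 2-stars free of any numbering, in which adjacency depends on the roles only and
-- the two stars can be exchanged.
record TwoStar {n} (G : SimpleGraph n) : Set where
  field
    role          : Fin n → Role
    adj-role      : ∀ u v → adj G u v ≡ roleAdj (role u) (role v)
    centre        : Bool → Fin n
    role-centre   : ∀ s → role (centre s) ≡ (true , s)
    centre-unique : ∀ {v s} → role v ≡ (true , s) → v ≡ centre s
    leaf          : ∀ s → ∃ λ v → role v ≡ (false , s)

dsRole : ℕ → ℕ → Role
dsRole a 0             = true , false
dsRole a 1             = true , true
dsRole a (suc (suc k)) = false , (a ≤ᵇ k)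

<ᵇ-≤ᵇ : ∀ k a → (k <ᵇ a) ≡ not (a ≤ᵇ k)
<ᵇ-≤ᵇ k       zero          = refl
<ᵇ-≤ᵇ zero    (suc a)       = refl
<ᵇ-≤ᵇ (suc k) (suc zero)    = refl
<ᵇ-≤ᵇ (suc k) (suc (suc a)) = <ᵇ-≤ᵇ k (suc a)

dsRole-adj : ∀ a i j → dsE a i j ∨ dsE a j i ≡ roleAdj (dsRole a i) (dsRole a j)
dsRole-adj a 0 0 = refl
dsRole-adj a 0 1 = refl
dsRole-adj a 0 (suc (suc k)) = trans (∨-identityʳ _) (<ᵇ-≤ᵇ k a)
dsRole-adj a 1 0 = refl
dsRole-adj a 1 1 = refl
dsRole-adj a 1 (suc (suc k)) = trans (∨-identityʳ _) (sym (not-involutive _))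
dsRole-adj a (suc (suc k)) 0 = trans (<ᵇ-≤ᵇ k a) (cong not (sym (Bool.xor-identityʳ _)))
dsRole-adj a (suc (suc k)) 1 = trans (sym (not-involutive _)) (cong not (Bool.xor-comm true (a ≤ᵇ k)))
dsRole-adj a (suc (suc k)) (suc (suc l)) = refl

0<⇒≰ᵇ0 : ∀ {a} → 0 < a → (a ≤ᵇ 0) ≡ false
0<⇒≰ᵇ0 (s≤s _) = refl

is2Star⇒TwoStar : ∀ {n} {G : SimpleGraph n} → Is2Star G → TwoStar G
is2Star⇒TwoStar {n} {G} (a , b , 1≤a , 1≤b , f , adj≡) = record
  { role          = role
  ; adj-role      = λ u v → trans (adj≡ u v) (dsRole-adj a (toℕ (F.to u)) (toℕ (F.to v)))
  ; centre        = λ s → proj₁ (F.strictlySurjective (c s))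
  ; role-centre   = λ s → trans (cong (dsRole a ∘ toℕ) (proj₂ (F.strictlySurjective (c s)))) (role-c s)
  ; centre-unique = λ {v} {s} eq → F.injective (trans (toℕ-injective (only (toℕ (F.to v)) s eq)) (sym (proj₂ (F.strictlySurjective (c s)))))
  ; leaf          = λ s → proj₁ (F.strictlySurjective (l s)) ,
                      trans (cong (dsRole a ∘ toℕ) (proj₂ (F.strictlySurjective (l s)))) (role-l s)
  }
  where
  module F = Bijection f
  role : Fin n → Role
  role v = dsRole a (toℕ (F.to v))
  c : Bool → Fin (2 + a + b)
  c false = zero
  c true  = suc zero
  role-c : ∀ s → dsRole a (toℕ (c s)) ≡ (true , s)
  role-c false = refl
  role-c true  = refl
  only : ∀ i s → dsRole a i ≡ (true , s) → i ≡ toℕ (c s)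
  only 0 false eq = refl
  only 1 true  eq = refl
  -- The first leaf of the first star has index 2, that of the second has index `2 + a`.
  l< : ∀ s → 2 + (if s then a else 0) < 2 + a + b
  l< false = s≤s (s≤s (ℕ.≤-trans 1≤a (ℕ.m≤m+n a b)))
  l< true  = s≤s (s≤s (subst (_≤ a + b) (ℕ.+-comm a 1) (ℕ.+-monoʳ-≤ a 1≤b)))
  l : Bool → Fin (2 + a + b)
  l s = fromℕ< (l< s)
  role-2+ : ∀ s → (a ≤ᵇ (if s then a else 0)) ≡ s
  role-2+ false = 0<⇒≰ᵇ0 1≤a
  role-2+ true = to T-≡ (ℕ.≤⇒≤ᵇ (ℕ.≤-refl {a}))
  role-l : ∀ s → dsRole a (toℕ (l s)) ≡ (false , s)
  role-l s = trans (cong (dsRole a) (toℕ-fromℕ< (l< s))) (cong (false ,_) (role-2+ s))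

-- The stars are determined only up to order; this serves the case in which they correspond
-- crosswise.
swapStars : ∀ {n} {G : SimpleGraph n} → TwoStar G → TwoStar G
swapStars {n} {G} T = record
  { role          = λ v → flip (role v)
  ; adj-role      = λ u v → trans (adj-role u v) (flip-adj (role u) (role v))
  ; centre        = λ s → centre (not s)
  ; role-centre   = λ s → trans (cong flip (role-centre (not s))) (cong (true ,_) (not-involutive s))
  ; centre-unique = λ {v} {s} eq → centre-unique (trans (sym (flip-flip (role v))) (cong flip eq))
  ; leaf          = λ s → proj₁ (leaf (not s)) , trans (cong flip (proj₂ (leaf (not s)))) (cong (false ,_) (not-involutive s))
  }
  where
  open TwoStar T
  flip : Role → Role
  flip (c , s) = c , not s
  flip-flip : ∀ r → flip (flip r) ≡ r
  flip-flip (c , s) = cong (c ,_) (not-involutive s)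
  flip-adj : ∀ r r' → roleAdj r r' ≡ roleAdj (flip r) (flip r')
  flip-adj (true  , false) (true  , s') = sym (not-involutive s')
  flip-adj (true  , true)  (true  , s') = refl
  flip-adj (true  , false) (false , s') = cong not (sym (not-involutive s'))
  flip-adj (true  , true)  (false , s') = refl
  flip-adj (false , false) (true  , s') = cong not (sym (not-involutive s'))
  flip-adj (false , true)  (true  , s') = refl
  flip-adj (false , s)     (false , s') = refl

-- `key` recovers from an entry the `x` it stems from, so different sublists are disjoint.
concatMap-unique : ∀ {A B : Set} (key : B → A) (f : A → List B) → (∀ x {y} → y ∈ f x → key y ≡ x) →
  (∀ x → Unique (f x)) → ∀ {xs} → Unique xs → Unique (concatMap f xs)
concatMap-unique key f key≡ !f [] = []
concatMap-unique key f key≡ !f {x ∷ xs} (x∉ ∷ !xs) =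
  Unique.++⁺ (!f x) (concatMap-unique key f key≡ !f !xs) λ (y∈ , y∈') →
    let x' , x'∈ , y∈fx' = find (∈-concatMap⁻ f {xs = xs} y∈') in
    All.lookup x∉ x'∈ (trans (sym (key≡ x y∈)) (key≡ x' y∈fx'))

module _ {n : ℕ} (G : SimpleGraph n) where

  private
    cell : Fin n → Fin n → List (Fin n × Fin n)
    cell u v = if adj G u v ∧ (toℕ u <ᵇ toℕ v) then [ (u , v) ] else []

    ∈-cell : ∀ u v {e} → e ∈ cell u v → e ≡ (u , v) × T (adj G u v ∧ (toℕ u <ᵇ toℕ v))
    ∈-cell u v e∈ with adj G u v ∧ (toℕ u <ᵇ toℕ v) | e∈
    ... | true | here refl = refl , _

    cell-∈ : ∀ u v → T (adj G u v ∧ (toℕ u <ᵇ toℕ v)) → (u , v) ∈ cell u v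
    cell-∈ u v t with adj G u v ∧ (toℕ u <ᵇ toℕ v)
    ... | true = here refl

    cell-unique : ∀ u v → Unique (cell u v)
    cell-unique u v with adj G u v ∧ (toℕ u <ᵇ toℕ v)
    ... | true  = [] ∷ []
    ... | false = []

    row : Fin n → List (Fin n × Fin n)
    row u = concatMap (cell u) (allFin n)

    ∈-row : ∀ u {e} → e ∈ row u → ∃ λ v → e ≡ (u , v) × T (adj G u v ∧ (toℕ u <ᵇ toℕ v))
    ∈-row u e∈ = let v , _ , e∈' = find (∈-concatMap⁻ (cell u) {xs = allFin n} e∈) in v , ∈-cell u v e∈'

  edges-unique : Unique (edges G)
  edges-unique = concatMap-unique proj₁ row (λ u e∈ → cong proj₁ (proj₁ (proj₂ (∈-row u e∈))))
    (λ u → concatMap-unique proj₂ (cell u) (λ v e∈ → cong proj₂ (proj₁ (∈-cell u v e∈))) (cell-unique u) (Unique.allFin⁺ n))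
    (Unique.allFin⁺ n)

  edges⁻ : ∀ {u v} → (u , v) ∈ edges G → adj G u v ≡ true × toℕ u < toℕ v
  edges⁻ {u} {v} e∈ with find (∈-concatMap⁻ row {xs = allFin n} e∈)
  ... | u' , _ , e∈' with ∈-row u' e∈'
  ...   | v' , refl , t with to T-∧ t
  ...     | p , q = to T-≡ p , ℕ.<ᵇ⇒< (toℕ u) (toℕ v) q

  edges⁺ : ∀ {u v} → adj G u v ≡ true → toℕ u < toℕ v → (u , v) ∈ edges G
  edges⁺ {u} {v} p q = ∈-concatMap⁺ row (lose (∈-allFin u) (∈-concatMap⁺ (cell u) (lose (∈-allFin v)
    (cell-∈ u v (from T-∧ (from T-≡ p , ℕ.<⇒<ᵇ q))))))

normalise-< : ∀ {n} {u v : Fin n} → toℕ u < toℕ v → normalise (u , v) ≡ (u , v)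
normalise-< {u = u} {v} u<v with toℕ u <ᵇ toℕ v | ℕ.<⇒<ᵇ u<v
... | true | _ = refl

normalise-≥ : ∀ {n} {u v : Fin n} → ¬ toℕ u < toℕ v → normalise (u , v) ≡ (v , u)
normalise-≥ {u = u} {v} u≮v with toℕ u <ᵇ toℕ v in eq
... | true  = contradiction (ℕ.<ᵇ⇒< (toℕ u) (toℕ v) (from T-≡ eq)) u≮v
... | false = refl

Unique-resp-↭ : ∀ {A : Set} {xs ys : List A} → xs ↭ ys → Unique xs → Unique ys
Unique-resp-↭ p = Permₛ.Unique-resp-↭ (≡.setoid _) (↭⇒↭ₛ p)

++-unique⁻ : ∀ {A : Set} (xs : List A) {ys} → Unique (xs ++ ys) → Unique xs × (∀ {v} → v ∈ xs → v ∉ ys)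
++-unique⁻ []       _          = [] , λ ()
++-unique⁻ (x ∷ xs) (x∉ ∷ !xs) = All.++⁻ˡ xs x∉ ∷ proj₁ (++-unique⁻ xs !xs) ,
  λ { (here refl) v∈ → All.lookup (All.++⁻ʳ xs x∉) v∈ refl ; (there v∈) → proj₂ (++-unique⁻ xs !xs) v∈ }

-- Edges and components of a 2-star

module Structure {n : ℕ} {G : SimpleGraph n} (T : TwoStar G) where
  open TwoStar T

  leaves : Bool → List (Fin n)
  leaves s = filter (λ v → role v ≟ᴿ (false , s)) (allFin n)

  ∈-leaves⁺ : ∀ {s v} → role v ≡ (false , s) → v ∈ leaves s
  ∈-leaves⁺ {s} {v} eq = ∈-filter⁺ (λ v → role v ≟ᴿ (false , s)) (∈-allFin v) eq

  ∈-leaves⁻ : ∀ {s v} → v ∈ leaves s → role v ≡ (false , s)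
  ∈-leaves⁻ {s} v∈ = proj₂ (∈-filter⁻ (λ v → role v ≟ᴿ (false , s)) {xs = allFin n} v∈)

  leaves-unique : ∀ s → Unique (leaves s)
  leaves-unique s = Unique.filter⁺ _ (Unique.allFin⁺ n)

  leaves-inhabited : ∀ s → 0 < length (leaves s)
  leaves-inhabited s = ∈-length (∈-leaves⁺ (proj₂ (leaf s)))

  allLeaves-unique : Unique (leaves false ++ leaves true)
  allLeaves-unique = Unique.++⁺ (leaves-unique false) (leaves-unique true)
    λ (p , q) → contradiction (trans (sym (∈-leaves⁻ p)) (∈-leaves⁻ q)) λ ()

  centre∉leaves : ∀ s → centre s ∉ leaves false ++ leaves true
  centre∉leaves s c∈ with ∈-++⁻ (leaves false) c∈
  ... | inj₁ p = contradiction (trans (sym (role-centre s)) (∈-leaves⁻ p)) λ ()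
  ... | inj₂ p = contradiction (trans (sym (role-centre s)) (∈-leaves⁻ p)) λ ()

  nonroot-unique : Unique (centre true ∷ leaves false ++ leaves true)
  nonroot-unique = All.tabulate (λ v∈ c≡v → centre∉leaves true (subst (_∈ _) (sym c≡v) v∈)) ∷ allLeaves-unique

  vertices-↭ : centre false ∷ centre true ∷ leaves false ++ leaves true ↭ allFin n
  vertices-↭ = unique-↭ (All.tabulate (λ { (here refl) c≡c → contradiction (trans (sym (role-centre false)) (trans (cong role c≡c) (role-centre true))) λ ()
                                        ; (there v∈) c≡v → centre∉leaves false (subst (_∈ _) (sym c≡v) v∈) }) ∷ nonroot-unique)
    (Unique.allFin⁺ n) (λ {v} _ → ∈-allFin v) (λ {v} _ → place (role v) refl)
    where
    place : ∀ {v} r → role v ≡ r → v ∈ centre false ∷ centre true ∷ leaves false ++ leaves true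
    place (true  , false) eq = here (centre-unique eq)
    place (true  , true)  eq = there (here (centre-unique eq))
    place (false , false) eq = there (there (∈-++⁺ˡ (∈-leaves⁺ eq)))
    place (false , true)  eq = there (there (∈-++⁺ʳ (leaves false) (∈-leaves⁺ eq)))

  size : n ≡ 2 + (length (leaves false) + length (leaves true))
  size = sym (trans (cong (2 +_) (sym (length-++ (leaves false)))) (trans (↭-length vertices-↭) (length-allFin n)))
    where
    length-allFin : ∀ n → length (allFin n) ≡ n
    length-allFin n = length-tabulate (λ i → i)

  -- Walks inside a block go through a fixed centre in at most 2 + 2 steps, and `conn` allows `n`.
  4≤n : 4 ≤ n
  4≤n = subst (4 ≤_) (sym size) (s≤s (s≤s (ℕ.+-mono-≤ (leaves-inhabited false) (leaves-inhabited true))))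

  edgeSet : (S S' : List (Fin n)) → List (Fin n × Fin n) → List (Fin n × Fin n)
  edgeSet S S' J = map (centre false ,_) S ++ map (centre true ,_) S' ++ J

  joinEdge : Fin n × Fin n
  joinEdge = centre false , centre true

  allEdges : List (Fin n × Fin n)
  allEdges = edgeSet (leaves false) (leaves true) [ joinEdge ]

  -- Edges directed away from the first centre, as `allEdges` lists them.
  data Link : Role → Role → Set where
    spoke₀ : Link (true , false) (false , false)
    spoke₁ : Link (true , true) (false , true)
    join   : Link (true , false) (true , true)

  link⇒adj : ∀ {r r'} → Link r r' → roleAdj r r' ≡ true
  link⇒adj spoke₀ = refl
  link⇒adj spoke₁ = refl
  link⇒adj join   = refl

  adj⇒link : ∀ r r' → roleAdj r r' ≡ true → Link r r' ⊎ Link r' r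
  adj⇒link (true  , false) (true  , true)  _ = inj₁ join
  adj⇒link (true  , true)  (true  , false) _ = inj₂ join
  adj⇒link (true  , false) (false , false) _ = inj₁ spoke₀
  adj⇒link (true  , true)  (false , true)  _ = inj₁ spoke₁
  adj⇒link (false , false) (true  , false) _ = inj₂ spoke₀
  adj⇒link (false , true)  (true  , true)  _ = inj₂ spoke₁

  allEdges⁻ : ∀ {u v} → (u , v) ∈ allEdges → Link (role u) (role v)
  allEdges⁻ e∈ with ∈-++⁻ (map (centre false ,_) (leaves false)) e∈
  ... | inj₁ p with ∈-map⁻ _ p
  ...   | y , y∈ , refl = subst₂ Link (sym (role-centre false)) (sym (∈-leaves⁻ y∈)) spoke₀
  allEdges⁻ e∈ | inj₂ q with ∈-++⁻ (map (centre true ,_) (leaves true)) q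
  ...   | inj₁ p with ∈-map⁻ _ p
  ...     | y , y∈ , refl = subst₂ Link (sym (role-centre true)) (sym (∈-leaves⁻ y∈)) spoke₁
  allEdges⁻ e∈ | inj₂ q | inj₂ (here refl) = subst₂ Link (sym (role-centre false)) (sym (role-centre true)) join

  allEdges⁺ : ∀ {u v r r'} → role u ≡ r → role v ≡ r' → Link r r' → (u , v) ∈ allEdges
  allEdges⁺ ru rv spoke₀ with refl ← centre-unique ru = ∈-++⁺ˡ (∈-map⁺ _ (∈-leaves⁺ rv))
  allEdges⁺ ru rv spoke₁ with refl ← centre-unique ru =
    ∈-++⁺ʳ (map (centre false ,_) (leaves false)) (∈-++⁺ˡ (∈-map⁺ _ (∈-leaves⁺ rv)))
  allEdges⁺ ru rv join with refl ← centre-unique ru | refl ← centre-unique rv =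
    ∈-++⁺ʳ (map (centre false ,_) (leaves false)) (∈-++⁺ʳ (map (centre true ,_) (leaves true)) (here refl))

  isChild : Role → Role → Bool
  isChild (true  , false) _               = true
  isChild (true  , true)  (true , false)  = false
  isChild (true  , true)  _               = true
  isChild (false , _)     _               = false

  child : Fin n × Fin n → Fin n
  child (u , v) = if isChild (role u) (role v) then v else u

  link⇒child : ∀ {r r'} → Link r r' → isChild r r' ≡ true × isChild r' r ≡ false
  link⇒child spoke₀ = refl , refl
  link⇒child spoke₁ = refl , refl
  link⇒child join   = refl , refl

  child-normalise : ∀ {e} → e ∈ allEdges → child (normalise e) ≡ proj₂ e
  child-normalise {u , v} e∈ with toℕ u <ᵇ toℕ v
  ... | true  = cong (if_then v else u) (proj₁ (link⇒child (allEdges⁻ e∈)))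
  ... | false = cong (if_then u else v) (proj₂ (link⇒child (allEdges⁻ e∈)))

  -- The child end of an edge (rooting the tree at the first centre) determines the edge.
  normalised-unique : Unique (map normalise allEdges)
  normalised-unique = Unique.map⁻ {f = child} (subst Unique (sym children)
    (Unique-resp-↭ (↭-trans (∷↭∷ʳ (centre true) _) (↭-reflexive (++-assoc (leaves false) _ _))) nonroot-unique))
    where
    children : map child (map normalise allEdges) ≡ leaves false ++ leaves true ++ [ centre true ]
    children = begin
      map child (map normalise allEdges)  ≡⟨ map-∘ allEdges ⟨
      map (child ∘ normalise) allEdges    ≡⟨ map-cong-local (All.tabulate child-normalise) ⟩
      map proj₂ allEdges                  ≡⟨ map-++ proj₂ (map (centre false ,_) (leaves false)) _ ⟩
      map proj₂ (map (centre false ,_) (leaves false)) ++ map proj₂ (map (centre true ,_) (leaves true) ++ [ joinEdge ])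
        ≡⟨ cong₂ _++_ (seconds (leaves false))
             (trans (map-++ proj₂ (map (centre true ,_) (leaves true)) _) (cong (_++ [ centre true ]) (seconds (leaves true)))) ⟩
      leaves false ++ leaves true ++ [ centre true ] ∎
      where
      open ≡-Reasoning
      seconds : ∀ {c : Fin n} (xs : List (Fin n)) → map proj₂ (map (c ,_) xs) ≡ xs
      seconds xs = trans (sym (map-∘ xs)) (map-id xs)

  edges-↭ : edges G ↭ map normalise allEdges
  edges-↭ = unique-↭ (edges-unique G) normalised-unique out into
    where
    out : ∀ {e} → e ∈ edges G → e ∈ map normalise allEdges
    out {u , v} e∈ with edges⁻ G e∈
    ... | a , u<v with adj⇒link (role u) (role v) (trans (sym (adj-role u v)) a)
    ...   | inj₁ l = subst (_∈ map normalise allEdges) (normalise-< u<v) (∈-map⁺ normalise (allEdges⁺ refl refl l))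
    ...   | inj₂ l = subst (_∈ map normalise allEdges) (normalise-≥ (ℕ.<⇒≯ u<v)) (∈-map⁺ normalise (allEdges⁺ refl refl l))
    into : ∀ {e} → e ∈ map normalise allEdges → e ∈ edges G
    into e∈ with ∈-map⁻ normalise e∈
    ... | (u , v) , uv∈ , refl with trans (adj-role u v) (link⇒adj (allEdges⁻ uv∈)) | ℕ.<-cmp (toℕ u) (toℕ v)
    ...   | a | tri< u<v _ _ = subst (_∈ edges G) (sym (normalise-< u<v)) (edges⁺ G a u<v)
    ...   | a | tri> u≮v _ v<u = subst (_∈ edges G) (sym (normalise-≥ u≮v)) (edges⁺ G (trans (adj-sym G v u) a) v<u)
    ...   | a | tri≈ _ u≡v _ with refl ← toℕ-injective u≡v = contradiction (trans (sym a) (adj-irrefl G u)) λ ()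

  private
    module _ {S U S' U' : List (Fin n)} (p : S ++ U ↭ leaves false) (p' : S' ++ U' ↭ leaves true) where
      picked unpicked : Bool → List (Fin n)
      picked false = S
      picked true  = S'
      unpicked false = U
      unpicked true  = U'

      picked-↭ : ∀ s → picked s ++ unpicked s ↭ leaves s
      picked-↭ false = p
      picked-↭ true  = p'

      role-picked : ∀ s {v} → v ∈ picked s → role v ≡ (false , s)
      role-picked s v∈ = ∈-leaves⁻ (∈-resp-↭ (picked-↭ s) (∈-++⁺ˡ v∈))

      role-unpicked : ∀ s {v} → v ∈ unpicked s → role v ≡ (false , s)
      role-unpicked s v∈ = ∈-leaves⁻ (∈-resp-↭ (picked-↭ s) (∈-++⁺ʳ (picked s) v∈))

      split-unique : ∀ s → Unique (picked s ++ unpicked s)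
      split-unique s = Unique-resp-↭ (↭-sym (picked-↭ s)) (leaves-unique s)

      star : Bool → List (Fin n)
      star s = centre s ∷ picked s

      star-side : ∀ {s v} → v ∈ star s → proj₂ (role v) ≡ s
      star-side {s} (here refl) = cong proj₂ (role-centre s)
      star-side {s} (there v∈)  = cong proj₂ (role-picked s v∈)

      star-unique : ∀ s → Unique (star s)
      star-unique s = All.tabulate (λ v∈ c≡v → contradiction
          (trans (sym (role-centre s)) (trans (cong role c≡v) (role-picked s v∈))) λ ())
        ∷ proj₁ (++-unique⁻ (picked s) (split-unique s))

      edgeSet⁻ : ∀ {J u v} → (u , v) ∈ edgeSet S S' J → (∃ λ s → u ≡ centre s × v ∈ picked s) ⊎ (u , v) ∈ J
      edgeSet⁻ e∈ with ∈-++⁻ (map (centre false ,_) S) e∈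
      ... | inj₁ q with ∈-map⁻ _ q
      ...   | y , y∈ , refl = inj₁ (false , refl , y∈)
      edgeSet⁻ e∈ | inj₂ e∈' with ∈-++⁻ (map (centre true ,_) S') e∈'
      ...   | inj₂ q = inj₂ q
      ...   | inj₁ q with ∈-map⁻ _ q
      ...     | y , y∈ , refl = inj₁ (true , refl , y∈)

      edgeSet⁺ : ∀ {J} s {v} → v ∈ picked s → (centre s , v) ∈ edgeSet S S' J
      edgeSet⁺ false v∈ = ∈-++⁺ˡ (∈-map⁺ _ v∈)
      edgeSet⁺ true  v∈ = ∈-++⁺ʳ (map (centre false ,_) S) (∈-++⁺ˡ (∈-map⁺ _ v∈))

      adjacent-star : ∀ {u v} → Adjacent (edgeSet S S' []) u v → ∃ λ s → u ∈ star s × v ∈ star s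
      adjacent-star (inj₁ e) with inj₁ (s , refl , v∈) ← edgeSet⁻ e = s , here refl , there v∈
      adjacent-star (inj₂ e) with inj₁ (s , refl , u∈) ← edgeSet⁻ e = s , there u∈ , here refl

      walk-to-centre : ∀ {J} s {v} → v ∈ star s → Walk (edgeSet S S' J) 1 v (centre s)
      walk-to-centre s (here refl) = stop
      walk-to-centre s (there v∈)  = extend stop (inj₂ (edgeSet⁺ s v∈))

      walk-from-centre : ∀ {J} s {v} → v ∈ star s → Walk (edgeSet S S' J) 1 (centre s) v
      walk-from-centre s (here refl) = stop
      walk-from-centre s (there v∈)  = extend stop (inj₁ (edgeSet⁺ s v∈))

      star-block : ∀ s → Block (edgeSet S S' []) (star s)
      star-block s = record
        { inhabited = centre s , here refl
        ; unique    = star-unique s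
        ; closed    = λ e u∈ → let s' , u∈' , v∈ = adjacent-star e in
                        subst (λ r → _ ∈ star r) (trans (sym (star-side u∈')) (star-side u∈)) v∈
        ; connected = λ u∈ v∈ → weaken _ (ℕ.≤-trans (s≤s (s≤s z≤n)) 4≤n) (append _ (walk-to-centre s u∈) (walk-from-centre s v∈))
        }

      joined : List (Fin n)
      joined = centre false ∷ centre true ∷ S ++ S'

      star⊆joined : ∀ s {v} → v ∈ star s → v ∈ joined
      star⊆joined false (here refl) = here refl
      star⊆joined true  (here refl) = there (here refl)
      star⊆joined false (there v∈)  = there (there (∈-++⁺ˡ v∈))
      star⊆joined true  (there v∈)  = there (there (∈-++⁺ʳ S v∈))

      joined⊆star : ∀ {v} → v ∈ joined → ∃ λ s → v ∈ star s
      joined⊆star (here refl)         = false , here refl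
      joined⊆star (there (here refl)) = true , here refl
      joined⊆star (there (there v∈)) with ∈-++⁻ S v∈
      ... | inj₁ q = false , there q
      ... | inj₂ q = true , there q

      adjacent-joined : ∀ {u v} → Adjacent (edgeSet S S' [ joinEdge ]) u v → u ∈ joined × v ∈ joined
      adjacent-joined (inj₁ e) with edgeSet⁻ e
      ... | inj₁ (s , refl , v∈) = star⊆joined s (here refl) , star⊆joined s (there v∈)
      ... | inj₂ (here refl)     = here refl , there (here refl)
      adjacent-joined (inj₂ e) with edgeSet⁻ e
      ... | inj₁ (s , refl , u∈) = star⊆joined s (there u∈) , star⊆joined s (here refl)
      ... | inj₂ (here refl)     = there (here refl) , here refl

      joinEdge∈ : joinEdge ∈ edgeSet S S' [ joinEdge ]
      joinEdge∈ = ∈-++⁺ʳ (map (centre false ,_) S) (∈-++⁺ʳ (map (centre true ,_) S') (here refl))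

      walk-to-root : ∀ {v} → v ∈ joined → Walk (edgeSet S S' [ joinEdge ]) 2 v (centre false)
      walk-to-root v∈ with joined⊆star v∈
      ... | false , v∈' = weaken _ (s≤s z≤n) (walk-to-centre false v∈')
      ... | true  , v∈' = extend (walk-to-centre true v∈') (inj₂ joinEdge∈)

      walk-from-root : ∀ {v} → v ∈ joined → Walk (edgeSet S S' [ joinEdge ]) 2 (centre false) v
      walk-from-root v∈ with joined⊆star v∈
      ... | false , v∈' = weaken _ (s≤s z≤n) (walk-from-centre false v∈')
      ... | true  , v∈' = append _ (extend {k = 0} stop (inj₁ joinEdge∈)) (walk-from-centre true v∈')

      blocks-↭ : centre false ∷ centre true ∷ (S ++ S') ++ (U ++ U') ↭ allFin n
      blocks-↭ = ↭-trans (prep _ (prep _ (↭-trans interchange (++⁺ p p')))) vertices-↭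
        where
        interchange : (S ++ S') ++ (U ++ U') ↭ (S ++ U) ++ (S' ++ U')
        interchange = ↭-trans (↭-reflexive (++-assoc S S' (U ++ U')))
          (↭-trans (++⁺ˡ S (shifts S' U)) (↭-reflexive (sym (++-assoc S U (S' ++ U')))))

      joined-block : Block (edgeSet S S' [ joinEdge ]) joined
      joined-block = record
        { inhabited = centre false , here refl
        ; unique    = proj₁ (++-unique⁻ joined (Unique-resp-↭ (↭-sym blocks-↭) (Unique.allFin⁺ n)))
        ; closed    = λ e _ → proj₂ (adjacent-joined e)
        ; connected = λ u∈ v∈ → weaken _ 4≤n (append _ (walk-to-root u∈) (walk-from-root v∈))
        }

      star∌unpicked : ∀ {s s' v} → v ∈ unpicked s → v ∉ star s'
      star∌unpicked {s} {s'} v∈ (here refl) =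
        contradiction (trans (sym (role-centre s')) (role-unpicked s v∈)) λ ()
      star∌unpicked {s} {s'} v∈ (there v∈') with refl ← cong proj₂ (trans (sym (role-unpicked s v∈)) (role-picked s' v∈')) =
        proj₂ (++-unique⁻ (picked s) (split-unique s)) v∈' v∈

      single-block : ∀ {A : List (Fin n × Fin n)} {v} → (∀ {u w} → Adjacent A u w → u ≢ v) → Block A [ v ]
      single-block isolated = record
        { inhabited = _ , here refl
        ; unique    = [] ∷ []
        ; closed    = λ { e (here refl) → contradiction refl (isolated e) }
        ; connected = λ { (here refl) (here refl) → stop }
        }

      singles-blocks : ∀ {A : List (Fin n × Fin n)} → (∀ s {v} → v ∈ unpicked s → ∀ {u w} → Adjacent A u w → u ≢ v) →
        All (Block A) (map [_] (U ++ U'))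
      singles-blocks isolated = All.map⁺ (All.++⁺ (All.tabulate (λ v∈ → single-block (isolated false v∈)))
                                                  (All.tabulate (λ v∈ → single-block (isolated true v∈))))

      separate-blocks : All (Block (edgeSet S S' [])) (star false ∷ star true ∷ map [_] (U ++ U'))
      separate-blocks = star-block false ∷ star-block true ∷
        singles-blocks λ { s v∈ e refl → let s' , u∈ , _ = adjacent-star e in star∌unpicked {s} {s'} v∈ u∈ }

      joined-blocks : All (Block (edgeSet S S' [ joinEdge ])) (joined ∷ map [_] (U ++ U'))
      joined-blocks = joined-block ∷
        singles-blocks λ { s v∈ e refl → let s' , u∈ = joined⊆star (proj₁ (adjacent-joined e)) in star∌unpicked {s} {s'} v∈ u∈ }

      separate-↭ : concat (star false ∷ star true ∷ map [_] (U ++ U')) ↭ allFin n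
      separate-↭ = ↭-trans (prep _ (↭-trans (shift (centre true) S _) (prep _
          (↭-reflexive (trans (cong (λ W → S ++ S' ++ W) (concat-map-[_] (U ++ U'))) (sym (++-assoc S S' _)))))))
        blocks-↭

      joined-↭ : concat (joined ∷ map [_] (U ++ U')) ↭ allFin n
      joined-↭ = ↭-trans (↭-reflexive (cong (joined ++_) (concat-map-[_] (U ++ U')))) blocks-↭

  module _ (R : CommutativeRing 0ℓ 0ℓ) (ω : Fin n → ℕ) (z : Mark → CommutativeRing.Carrier R) where
    open CommutativeRing R using (Carrier; _≈_; setoid; +-cong; distribˡ; *-cong; *-comm; *-assoc)
      renaming (_+_ to _⊹_; _*_ to _·_; refl to ≈-refl; sym to ≈-sym; trans to ≈-trans; reflexive to ≈-reflexive)
    open import Relation.Binary.Reasoning.Setoid setoid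

    private
      Z : List (Fin n) → Carrier
      Z B = z (blockMark ω B)

    splitTerm : (S U S' U' : List (Fin n)) → Carrier
    splitTerm S U S' U' = ΠR R (map (λ v → Z [ v ]) U) · ΠR R (map (λ v → Z [ v ]) U')
      · (Z (centre false ∷ S) · Z (centre true ∷ S') ⊹ Z (centre false ∷ centre true ∷ S ++ S'))

    -- Two edge sets that differ only in the edge between the centres have the same lone leaves,
    -- whose factor can be taken out.
    term-split : ∀ {S U S' U'} → S ++ U ↭ leaves false → S' ++ U' ↭ leaves true →
      term R ω z (edgeSet S S' []) ⊹ term R ω z (edgeSet S S' [ joinEdge ]) ≈ splitTerm S U S' U'
    term-split {S} {U} {S'} {U'} p p' = begin
      term R ω z (edgeSet S S' []) ⊹ term R ω z (edgeSet S S' [ joinEdge ])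
        ≈⟨ +-cong (term-blocks R ω z _ _ (separate-blocks {S} {U} {S'} {U'} p p') (separate-↭ {S} {U} {S'} {U'} p p'))
                  (term-blocks R ω z _ _ (joined-blocks {S} {U} {S'} {U'} p p') (joined-↭ {S} {U} {S'} {U'} p p')) ⟩
      a · (b · w) ⊹ c · w    ≈⟨ +-cong (≈-trans (≈-sym (*-assoc a b w)) (*-comm (a · b) w)) (*-comm c w) ⟩
      w · (a · b) ⊹ w · c    ≈⟨ distribˡ w (a · b) c ⟨
      w · (a · b ⊹ c)        ≈⟨ *-cong w≈ ≈-refl ⟩
      splitTerm S U S' U'    ∎
      where
      a = Z (centre false ∷ S)
      b = Z (centre true ∷ S')
      c = Z (centre false ∷ centre true ∷ S ++ S')
      w = ΠR R (map Z (map [_] (U ++ U')))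
      w≈ : w ≈ ΠR R (map (λ v → Z [ v ]) U) · ΠR R (map (λ v → Z [ v ]) U')
      w≈ = ≈-trans (≈-reflexive (cong (ΠR R) (trans (sym (map-∘ (U ++ U'))) (map-++ _ U U'))))
                   (ΠR-++ R (map (λ v → Z [ v ]) U) (map (λ v → Z [ v ]) U'))

    evalM-split : evalM R G (markOf ω) z ≈
      Σsplit R (leaves false) λ S U → Σsplit R (leaves true) λ S' U' → splitTerm S U S' U'
    evalM-split = begin
      evalM R G (markOf ω) z
        ≈⟨ ΣR-subsets R (edges G) t ⟩
      Σsub R (edges G) t
        ≈⟨ Σsub-↭ R edges-↭ t (λ q → ≈-reflexive (term-↭ R ω z q)) ⟩
      Σsub R (map normalise allEdges) t
        ≡⟨ Σsub-map R normalise allEdges t ⟩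
      Σsub R allEdges (t ∘ map normalise)
        ≈⟨ Σsub-cong R allEdges (λ A → ≈-reflexive (term-normalise R ω z A)) ⟩
      Σsub R allEdges t
        ≡⟨ trans (Σsub-++ R (map (centre false ,_) (leaves false)) _ t) (Σsub-map R (centre false ,_) (leaves false) _) ⟩
      Σsub R (leaves false) (λ S → Σsub R (map (centre true ,_) (leaves true) ++ [ joinEdge ]) (λ A → t (map (centre false ,_) S ++ A)))
        -- The innermost sum, over the subsets of `[ joinEdge ]`, unfolds to the two terms of
        -- `term-split`.
        ≈⟨ Σsub-Σsplit R (leaves false) (λ S U p → ≈-trans
             (≈-reflexive (trans (Σsub-++ R (map (centre true ,_) (leaves true)) _ _) (Σsub-map R (centre true ,_) (leaves true) _)))
             (Σsub-Σsplit R (leaves true) (λ S' U' p' → term-split {S} {U} {S'} {U'} p p'))) ⟩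
      (Σsplit R (leaves false) λ S U → Σsplit R (leaves true) λ S' U' → splitTerm S U S' U') ∎
      where
      t : List (Fin n × Fin n) → Carrier
      t = term R ω z

-- Reconstruction

∸2-+2 : ∀ {w} → 2 ≤ w → w ≡ 2 + (w ∸ 2)
∸2-+2 (s≤s (s≤s _)) = refl

module Value {n : ℕ} {G : SimpleGraph n} (T : TwoStar G) (ω : Fin n → ℕ) (strict : StrictlyWeighted ω) (k m : ℕ) where
  open TwoStar T
  open Structure T
  open Evaluation k m

  τ : Fin n → ℕ
  τ v = ω v ∸ 2

  -- Strictness gives every weight the form `2 + τ v`; the total is arranged in the shape that
  -- `Dbullet-value` expects.
  blockWeight : ∀ v S → sum (map ω (v ∷ S)) ≡ length S + (2 + (length S + (τ v + sum (map τ S))))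
  blockWeight v []      = cong (_+ 0) (∸2-+2 (strict v))
  blockWeight v (u ∷ S) = trans (cong₂ _+_ (∸2-+2 (strict v)) (blockWeight u S))
                                (step (τ v) (length S) (τ u + sum (map τ S)))
    where
    step : ∀ a l b → 2 + a + (l + (2 + (l + b))) ≡ 1 + l + (2 + (1 + l + (a + b)))
    step = ℕ.solve-∀

  Dbullet-block : ∀ v S → Dbullet dualNumbers ζ (blockMark ω (v ∷ S)) ≡ bullet (length S) (τ v + sum (map τ S))
  Dbullet-block v S = trans (cong (λ w → Dbullet dualNumbers ζ (w , length S)) (blockWeight v S))
                            (Dbullet-value (length S) (τ v + sum (map τ S)))

  Dbullet-singles : ∀ U → ΠR dualNumbers (map (λ v → Dbullet dualNumbers ζ (blockMark ω [ v ])) U) ≡ singles (map τ U)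
  Dbullet-singles []      = refl
  Dbullet-singles (v ∷ U) = cong₂ _⊛_ (trans (Dbullet-block v []) (cong (bullet 0) (ℕ.+-identityʳ (τ v)))) (Dbullet-singles U)

  leafWeights : Bool → List ℕ
  leafWeights s = map τ (leaves s)

  evalD-value : evalD dualNumbers G (markOf ω) ζ ≡
    ι (c ^ (2 + (length (leafWeights false) + length (leafWeights true))))
      (k ^ (1 + (length (leafWeights false) + length (leafWeights true)))
       * (x * subtreePoly x m (τ (centre false)) (leafWeights false) (τ (centre true)) (leafWeights true)))
  evalD-value = begin
    evalD dualNumbers G (markOf ω) ζ
      ≡⟨ evalM-split dualNumbers ω (Dbullet dualNumbers ζ) ⟩
    (Σsplit dualNumbers (leaves false) λ S U → Σsplit dualNumbers (leaves true) λ S' U' →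
      splitTerm dualNumbers ω (Dbullet dualNumbers ζ) S U S' U')
      ≡⟨ Σsplit-cong dualNumbers (leaves false) (λ S U → trans
           (Σsplit-cong dualNumbers (leaves true) (λ S' U' → splitTerm≡ S U S' U'))
           (sym (Σsplit-map dualNumbers τ (leaves true) (summand (map τ S) (map τ U))))) ⟩
    (Σsplit dualNumbers (leaves false) λ S U → Σsplit dualNumbers (leafWeights true) (summand (map τ S) (map τ U)))
      ≡⟨ Σsplit-map dualNumbers τ (leaves false) (λ S U → Σsplit dualNumbers (leafWeights true) (summand S U)) ⟨
    twoStarSum p (leafWeights false) q (leafWeights true)
      ≡⟨ twoStarSum-value p (leafWeights false) q (leafWeights true) ⟩
    _ ∎
    where
    open ≡-Reasoning
    p = τ (centre false)
    q = τ (centre true)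
    summand : List ℕ → List ℕ → List ℕ → List ℕ → ℤ × ℤ
    summand S U S' U' = singles U ⊛ singles U' ⊛
      (bullet (length S) (p + sum S) ⊛ bullet (length S') (q + sum S')
       ⊕ bullet (suc (length S + length S')) (p + q + (sum S + sum S')))
    bullet-map : ∀ a S → bullet (length S) (a + sum (map τ S)) ≡ bullet (length (map τ S)) (a + sum (map τ S))
    bullet-map a S = cong (λ l → bullet l (a + sum (map τ S))) (sym (length-map τ S))
    joined≡ : ∀ S S' → Dbullet dualNumbers ζ (blockMark ω (centre false ∷ centre true ∷ S ++ S'))
      ≡ bullet (suc (length (map τ S) + length (map τ S'))) (p + q + (sum (map τ S) + sum (map τ S')))
    joined≡ S S' = trans (Dbullet-block (centre false) (centre true ∷ S ++ S')) (cong₂ (λ l w → bullet (suc l) w)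
      (trans (length-++ S) (sym (cong₂ _+_ (length-map τ S) (length-map τ S'))))
      (trans (cong (λ w → p + (q + w)) (trans (cong sum (map-++ τ S S')) (sum-++ (map τ S) (map τ S')))) (sym (ℕ.+-assoc p q _))))
    splitTerm≡ : ∀ S U S' U' → splitTerm dualNumbers ω (Dbullet dualNumbers ζ) S U S' U' ≡ summand (map τ S) (map τ U) (map τ S') (map τ U')
    splitTerm≡ S U S' U' = cong₂ _⊛_ (cong₂ _⊛_ (Dbullet-singles U) (Dbullet-singles U'))
      (cong₂ _⊕_ (cong₂ _⊛_ (trans (Dbullet-block (centre false) S) (bullet-map p S))
                            (trans (Dbullet-block (centre true) S') (bullet-map q S')))
                 (joined≡ S S'))

lookup-injective : ∀ {A : Set} {xs : List A} → Unique xs → ∀ i j → lookup xs i ≡ lookup xs j → i ≡ j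
lookup-injective {xs = x ∷ xs} (x∉ ∷ !xs) zero    zero    eq = refl
lookup-injective {xs = x ∷ xs} (x∉ ∷ !xs) zero    (suc j) eq = contradiction eq (All.lookup x∉ (∈-lookup j))
lookup-injective {xs = x ∷ xs} (x∉ ∷ !xs) (suc i) zero    eq = contradiction (sym eq) (All.lookup x∉ (∈-lookup i))
lookup-injective {xs = x ∷ xs} (x∉ ∷ !xs) (suc i) (suc j) eq = cong suc (lookup-injective !xs i j eq)

allFin-bijection : ∀ {X : Set} {n n'} (h : Fin n → X) (h' : Fin n' → X) → map h (allFin n) ↭ map h' (allFin n') →
  Σ (Fin n ⤖ Fin n') λ f → ∀ v → h v ≡ h' (Bijection.to f v)
-- `ys` rearranges the vertices of the second graph so that the labels match position by position;
-- `lookup ys` is then the bijection.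
allFin-bijection {X} {n} {n'} h h' p with ↭-map-inv h' (↭-sym p)
... | ys , eq , q = go ys (trans (sym (length-tabulate h)) (trans (cong length (sym (map-tabulate (λ i → i) h))) (trans (cong length eq) (length-map h' ys)))) eq q
  where
  go : ∀ ys → n ≡ length ys → map h (allFin n) ≡ map h' ys → allFin n' ↭ ys →
    Σ (Fin n ⤖ Fin n') λ f → ∀ v → h v ≡ h' (Bijection.to f v)
  go ys refl eq q = mk⤖ {to = lookup ys} (lookup-injective (Unique-resp-↭ q (Unique.allFin⁺ n')) _ _ ,
      λ w → Any.index (at w) , λ { refl → sym (lookup-index (at w)) }) ,
    pointwise ys h (trans (sym (map-tabulate (λ i → i) h)) eq)
    where
    at : ∀ w → w ∈ ys
    at w = ∈-resp-↭ q (∈-allFin w)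
    pointwise : ∀ ys (h : Fin (length ys) → X) → tabulate h ≡ map h' ys → ∀ v → h v ≡ h' (lookup ys v)
    pointwise (y ∷ ys) h eq zero    = cong (λ { (x ∷ _) → x ; [] → h zero }) eq
    pointwise (y ∷ ys) h eq (suc v) = pointwise ys (h ∘ suc) (cong (drop 1) eq) v

module _ {n n'} {G : SimpleGraph n} {G' : SimpleGraph n'} {ω : Fin n → ℕ} {ω' : Fin n' → ℕ}
  (T : TwoStar G) (T' : TwoStar G') (strict : StrictlyWeighted ω) (strict' : StrictlyWeighted ω') where
  private
    module T  = TwoStar T
    module T' = TwoStar T'
    module S  = Structure T
    module S' = Structure T'
    τ : Fin n → ℕ
    τ v = ω v ∸ 2
    τ' : Fin n' → ℕ
    τ' v = ω' v ∸ 2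

  -- Each vertex is labelled with its role and its weight. A bijection preserving these labels
  -- preserves adjacency, which depends on the roles alone.
  ωIso-from-weights : (∀ s → τ (T.centre s) ≡ τ' (T'.centre s)) →
    (∀ s → map τ (S.leaves s) ↭ map τ' (S'.leaves s)) → ωIso G ω G' ω'
  ωIso-from-weights centres leaves = f ,
      (λ u v → trans (T.adj-role u v) (trans (cong₂ roleAdj (cong proj₁ (h≡ u)) (cong proj₁ (h≡ v))) (sym (T'.adj-role _ _)))) ,
      (λ v → trans (∸2-+2 (strict v)) (trans (cong (2 +_) (cong proj₂ (h≡ v))) (sym (∸2-+2 (strict' _)))))
    where
    h : Fin n → Role × ℕ
    h v = T.role v , τ v
    h' : Fin n' → Role × ℕ
    h' v = T'.role v , τ' v
    leafData : ∀ s → map h (S.leaves s) ↭ map h' (S'.leaves s)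
    leafData s = subst₂ _↭_
      (trans (sym (map-∘ (S.leaves s))) (map-cong-local (All.tabulate λ v∈ → cong (_, _) (sym (S.∈-leaves⁻ v∈)))))
      (trans (sym (map-∘ (S'.leaves s))) (map-cong-local (All.tabulate λ v∈ → cong (_, _) (sym (S'.∈-leaves⁻ v∈)))))
      (map⁺ ((false , s) ,_) (leaves s))
    centreData : ∀ s → h (T.centre s) ≡ h' (T'.centre s)
    centreData s = cong₂ _,_ (trans (T.role-centre s) (sym (T'.role-centre s))) (centres s)
    vertexData : h (T.centre false) ∷ h (T.centre true) ∷ map h (S.leaves false ++ S.leaves true)
      ↭ h' (T'.centre false) ∷ h' (T'.centre true) ∷ map h' (S'.leaves false ++ S'.leaves true)
    vertexData = ↭-trans (prep _ (prep _ (subst₂ _↭_ (sym (map-++ h (S.leaves false) (S.leaves true)))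
        (sym (map-++ h' (S'.leaves false) (S'.leaves true))) (++⁺ (leafData false) (leafData true)))))
      (↭-reflexive (cong₂ (λ a b → a ∷ b ∷ map h' (S'.leaves false ++ S'.leaves true)) (centreData false) (centreData true)))
    bijection = allFin-bijection h h'
      (↭-trans (map⁺ h (↭-sym S.vertices-↭)) (↭-trans vertexData (map⁺ h' S'.vertices-↭)))
    f = proj₁ bijection
    h≡ = proj₂ bijection

leaves-swapStars : ∀ {n} {G : SimpleGraph n} (T : TwoStar G) s →
  Structure.leaves (swapStars T) s ↭ Structure.leaves T (not s)
leaves-swapStars T s = unique-↭ (Structure.leaves-unique (swapStars T) s) (Structure.leaves-unique T (not s))
  (λ {v} v∈ → Structure.∈-leaves⁺ T (cong₂ _,_ (cong proj₁ (Structure.∈-leaves⁻ (swapStars T) v∈))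
    (trans (sym (not-involutive (proj₂ (TwoStar.role T v)))) (cong (not ∘ proj₂) (Structure.∈-leaves⁻ (swapStars T) v∈)))))
  (λ v∈ → Structure.∈-leaves⁺ (swapStars T) (trans (cong (λ (c , r) → c , not r) (Structure.∈-leaves⁻ T v∈))
    (cong (false ,_) (not-involutive s))))

theorem7p18 : ∀ {n n'} (T : SimpleGraph n) (ω : Fin n → ℕ)
    (T' : SimpleGraph n') (ω' : Fin n' → ℕ) →
    Is2Star T → StrictlyWeighted ω →
    Is2Star T' → StrictlyWeighted ω' →
    DEqual T (markOf ω) T' (markOf ω') →
    ωIso T ω T' ω'
theorem7p18 {n} {n'} T ω T' ω' 2star strict 2star' strict' D≡ =
  conclude (2-star-determined p A q B p' A' q' B' A>0 B>0 A'>0 B'>0 sizes subtreePoly≡)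
  where
  X : TwoStar T
  X = is2Star⇒TwoStar {G = T} 2star
  X' : TwoStar T'
  X' = is2Star⇒TwoStar {G = T'} 2star'
  open TwoStar X using (centre)
  open Structure X using (leaves; leaves-inhabited)
  open TwoStar X' using () renaming (centre to centre')
  open Structure X' using () renaming (leaves to leaves'; leaves-inhabited to leaves-inhabited')
  τ : Fin n → ℕ
  τ v = ω v ∸ 2
  τ' : Fin n' → ℕ
  τ' v = ω' v ∸ 2
  p = τ (centre false)
  A = map τ (leaves false)
  q = τ (centre true)
  B = map τ (leaves true)
  p' = τ' (centre' false)
  A' = map τ' (leaves' false)
  q' = τ' (centre' true)
  B' = map τ' (leaves' true)
  A>0 : 0 < length A
  A>0 = subst (0 <_) (sym (length-map τ (leaves false))) (leaves-inhabited false)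
  B>0 : 0 < length B
  B>0 = subst (0 <_) (sym (length-map τ (leaves true))) (leaves-inhabited true)
  A'>0 : 0 < length A'
  A'>0 = subst (0 <_) (sym (length-map τ' (leaves' false))) (leaves-inhabited' false)
  B'>0 : 0 < length B'
  B'>0 = subst (0 <_) (sym (length-map τ' (leaves' true))) (leaves-inhabited' true)
  values : ∀ k m → _ ≡ _
  values k m = trans (sym (Value.evalD-value X ω strict k m))
    (trans (D≡ dualNumbers (Evaluation.ζ k m)) (Value.evalD-value X' ω' strict' k m))
  sizes : length A + length B ≡ length A' + length B'
  -- At `k = 1`, `m = 2` the real part is 2 to the number of vertices.
  sizes = ℕ.+-cancelˡ-≡ 2 _ _ (^-injectiveʳ 2 (s≤s z<s) (ℤ.+-injective (cong proj₁ (values 1 2))))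
  subtreePoly≡ : ∀ k m → subtreePoly (2 + k) m p A q B ≡ subtreePoly (2 + k) m p' A' q' B'
  -- Evaluating at `suc k` makes `x` equal to `2 + k` and the factor `suc k ^ (1 + l)` nonzero, so
  -- that both cancel.
  subtreePoly≡ k m = ℕ.*-cancelˡ-≡ _ _ (2 + k) (ℕ.*-cancelˡ-≡ _ _ (suc k ^ (1 + l)) {{ℕ.m^n≢0 (suc k) (1 + l)}}
    (trans (ℤ.+-injective (cong proj₂ (values (suc k) m)))
      (cong (λ i → suc k ^ (1 + i) * ((2 + k) * subtreePoly (2 + k) m p' A' q' B')) (sym sizes))))
    where l = length A + length B
  conclude : _ → ωIso T ω T' ω'
  conclude (inj₁ ((p≡ , A↭) , (q≡ , B↭))) = ωIso-from-weights X X' strict strict'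
    (λ { false → p≡ ; true → q≡ }) (λ { false → A↭ ; true → B↭ })
  conclude (inj₂ ((p≡ , A↭) , (q≡ , B↭))) = ωIso-from-weights X (swapStars X') strict strict'
    (λ { false → p≡ ; true → q≡ })
    (λ { false → ↭-trans A↭ (map⁺ τ' (↭-sym (leaves-swapStars X' false)))
       ; true  → ↭-trans B↭ (map⁺ τ' (↭-sym (leaves-swapStars X' true))) })
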